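{- Let $\Delta$ be a positive integer and let $G$ be a finite simple graph of maximum degree at most $\Delta$ without isolated vertices. Then \[ \nu_{ur}(G) \geq \frac{n(G)}{\Delta} - \frac{m(G)}{\Delta^2}, \] with equality if and only if each connected component of $G$ is isomorphic to a complete bipartite graph $K_{\Delta,r}$ for some $r\in\{1,2,\ldots,\Delta\}$.
   Context: All graphs are simple, finite and undirected. A matching in $G$ is a set of pairwise non-adjacent edges. A matching $M$ in $G$ is uniquely restricted if no other matching in $G$ covers exactly the same set of vertices as $M$. $\nu_{ur}(G)$ denotes the maximum size of a uniquely restricted matching in $G$. $n(G)$ and $m(G)$ denote the number of vertices and the number of edges of $G$, respectively. -}

module Defs where

open import Data.Nat using (ℕ; zero; suc; _+_; _*_; _≤_; _<ᵇ_)
open import Data.Fin using (Fin; toℕ)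
import Data.Fin as F
open import Data.Bool using (Bool; true; false; if_then_else_; _∧_; _xor_)
open import Data.Product using (Σ; ∃; _×_; _,_)
open import Relation.Binary.PropositionalEquality using (_≡_)
open import Function.Bundles using (_⇔_)
open import Function.Definitions using (Injective)

sumFin : (n : ℕ) → (Fin n → ℕ) → ℕ
sumFin zero    f = 0
sumFin (suc n) f = f F.zero + sumFin n (λ i → f (F.suc i))

countFin : (n : ℕ) → (Fin n → Bool) → ℕ
countFin n b = sumFin n (λ i → if b i then 1 else 0)

record Graph : Set where
  field
    n      : ℕ
    adj    : Fin n → Fin n → Bool
    sym    : ∀ i j → adj i j ≡ adj j i
    irrefl : ∀ i → adj i i ≡ false
open Graph public

pairCount : (n : ℕ) → (Fin n → Fin n → Bool) → ℕ
pairCount n r = sumFin n (λ i → countFin n (λ j → (toℕ i <ᵇ toℕ j) ∧ r i j))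

edges : Graph → ℕ
edges G = pairCount (n G) (adj G)

degree : (G : Graph) → Fin (n G) → ℕ
degree G v = countFin (n G) (adj G v)

record Matching (G : Graph) : Set where
  field
    M       : Fin (n G) → Fin (n G) → Bool
    M-sym   : ∀ i j → M i j ≡ M j i
    M-edge  : ∀ i j → M i j ≡ true → adj G i j ≡ true
    M-disj  : ∀ i j k → M i j ≡ true → M i k ≡ true → j ≡ k
open Matching public

size : {G : Graph} → Matching G → ℕ
size {G} μ = pairCount (n G) (M μ)

Covered : {G : Graph} → Matching G → Fin (n G) → Set
Covered μ v = ∃ λ u → M μ v u ≡ true

UniquelyRestricted : {G : Graph} → Matching G → Set
UniquelyRestricted {G} μ =
  (μ' : Matching G) → (∀ v → Covered μ v ⇔ Covered μ' v) → ∀ i j → M μ i j ≡ M μ' i j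

IsNuUR : Graph → ℕ → Set
IsNuUR G k =
  (Σ (Matching G) λ μ → UniquelyRestricted μ × size μ ≡ k)
  × ((μ : Matching G) → UniquelyRestricted μ → size μ ≤ k)

data Reach (G : Graph) : Fin (n G) → Fin (n G) → Set where
  here : ∀ {u} → Reach G u u
  step : ∀ {u w x} → adj G u w ≡ true → Reach G w x → Reach G u x

-- Complete bipartite graph K_{a,b} on Fin (a + b): parts {i < a} and {i ≥ a}
Kadj : (a b : ℕ) → Fin (a + b) → Fin (a + b) → Bool
Kadj a b i j = (toℕ i <ᵇ a) xor (toℕ j <ᵇ a)

ComponentIsoK : (G : Graph) → Fin (n G) → (a b : ℕ) → Set
ComponentIsoK G v a b =
  Σ (Fin (a + b) → Fin (n G)) λ f →
    Injective _≡_ _≡_ f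
    × (∀ u → Reach G v u ⇔ (∃ λ i → f i ≡ u))
    × (∀ i j → adj G (f i) (f j) ≡ Kadj a b i j)

{-# OPTIONS --safe #-}

-- Greedy argument. Let a have minimum degree in G[S], let B be its neighbourhood there, and let A be
-- the set of vertices isolated by deleting B. By minimality every vertex of A has neighbourhood B.
-- Put an edge at a into the matching and continue with S ∖ (A ∪ B): since a sees no later vertex, the
-- matching obtained is uniquely restricted. The step costs Δ(|A| + |B|) − e with e ≥ |A||B| removed
-- edges, which is at most Δ² − (Δ − |A|)(Δ − |B|) ≤ Δ²; in case of equality A ∪ B is a component
-- K_{Δ,|B|}. Conversely, a uniquely restricted matching cannot cover two vertices with the same
-- neighbourhood (exchanging them gives another matching), so it has at most one edge in each K_{Δ,r}.
module Submission where

open import Defs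
open import Data.Nat using (ℕ; zero; suc; _+_; _*_; _∸_; _≤_; _<_; z≤n; s≤s; _<ᵇ_)
open import Data.Nat.Properties hiding (_≟_; suc-injective)
open import Data.Nat.Tactic.RingSolver using (solve-∀)
open import Data.Fin using (Fin; toℕ; _≟_; _↑ˡ_; _↑ʳ_; splitAt)
import Data.Fin as F
open import Data.Fin.Properties using (suc-injective; toℕ-injective; ↑ˡ-injective; ↑ʳ-injective; any?; toℕ<n; toℕ-↑ˡ; toℕ-↑ʳ; splitAt-↑ˡ; splitAt-↑ʳ; splitAt⁻¹-↑ˡ; splitAt⁻¹-↑ʳ)
open import Data.Fin.Permutation.Components using (transpose; transpose-inverse)
open import Data.Bool using (Bool; true; false; _∧_; _∨_; not; if_then_else_; _xor_)
open import Data.Bool.Properties using (∧-zeroʳ)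
open import Data.Product using (∃; Σ; _×_; _,_; proj₁; proj₂)
open import Data.Sum using (_⊎_; inj₁; inj₂; [_,_]′)
open import Data.Empty using (⊥; ⊥-elim)
open import Relation.Nullary using (yes; no; ⌊_⌋)
open import Relation.Binary.PropositionalEquality using (_≡_; _≢_; refl; trans; cong; cong₂; subst; module ≡-Reasoning) renaming (sym to ≡-sym)
open import Function.Bundles using (_⇔_; mk⇔; Equivalence)
open import Function.Definitions using (Injective)

-- With p = Δ - |A| and q = Δ - |B|, the cost Δ(|A| + |B|) - |A||B| equals Δ² - pq, so the bound Δ²
-- rests on both sets having at most Δ vertices: B is a neighbourhood of a, and A lies in the
-- neighbourhood of any vertex of B. Deleting A together with B keeps the remaining graph free of
-- isolated vertices. To reach the equality case, the estimate is carried as an exact equation: pq,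
-- the edges inside B and the edges from B to the remaining vertices are collected in a slack, and
-- equality makes each of them vanish at every step. Two points then remain. First, pq = 0 allows
-- |B| = Δ with |A| < Δ, which the minimality of the degree of a excludes. Second, a component found
-- in the remaining graph has to be a component of the graph before the deletion; this holds because
-- no edge joins A ∪ B to the rest. Everything stays in the natural numbers: the inequality is
-- multiplied by 2Δ², the factor 2 coming from counting each edge once in each direction.

ι : Bool → ℕ
ι b = if b then 1 else 0

Subset : ℕ → Set
Subset N = Fin N → Bool

infix 4 _∈_ _∉_
_∈_ _∉_ : {N : ℕ} → Fin N → Subset N → Set
v ∈ S = S v ≡ true
v ∉ S = S v ≡ false

-- Booleans and their values 0 and 1

true≢false : {b : Bool} → b ≡ true → b ≡ false → ⊥
true≢false refl ()

bool-ext : {x y : Bool} → (x ≡ true → y ≡ true) → (y ≡ true → x ≡ true) → x ≡ y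
bool-ext {true}  {true}  p q = refl
bool-ext {true}  {false} p q = ≡-sym (p refl)
bool-ext {false} {true}  p q = q refl
bool-ext {false} {false} p q = refl

ι-mono : {x y : Bool} → (x ≡ true → y ≡ true) → ι x ≤ ι y
ι-mono {true}  p rewrite p refl = ≤-refl
ι-mono {false} p = z≤n

ι≤1 : (b : Bool) → ι b ≤ 1
ι≤1 true  = ≤-refl
ι≤1 false = z≤n

ι≡0 : {b : Bool} → ι b ≡ 0 → b ≡ false
ι≡0 {false} _ = refl

∧-true : ∀ {x y} → x ∧ y ≡ true → x ≡ true × y ≡ true
∧-true {true} {true} _ = refl , refl

∧-intro : ∀ {x y} → x ≡ true → y ≡ true → x ∧ y ≡ true
∧-intro refl refl = refl

∨-true : ∀ {x y} → x ∨ y ≡ true → x ≡ true ⊎ y ≡ true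
∨-true {true}  _ = inj₁ refl
∨-true {false} e = inj₂ e

∨-introˡ : ∀ {x} y → x ≡ true → x ∨ y ≡ true
∨-introˡ y refl = refl

∨-introʳ : ∀ x {y} → y ≡ true → x ∨ y ≡ true
∨-introʳ true  _ = refl
∨-introʳ false e = e

not-true : ∀ {x} → not x ≡ true → x ≡ false
not-true {false} _ = refl

ι-∧ : ∀ x y → ι (x ∧ y) ≡ ι x * ι y
ι-∧ true  y = ≡-sym (+-identityʳ _)
ι-∧ false y = refl

ι-∨ : ∀ x y → (x ≡ true → y ≡ false) → ι (x ∨ y) ≡ ι x + ι y
ι-∨ true  y h rewrite h refl = refl
ι-∨ false y h = refl

ι-split : ∀ x y → ι x ≡ ι (x ∧ not y) + ι (x ∧ y)
ι-split true  true  = refl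
ι-split true  false = refl
ι-split false y     = refl

-- The descent step of the recursions on a bound for the number of vertices left: c is the number of
-- vertices removed.
m+n≤1+o⇒m≤o : ∀ {a b c} → 1 ≤ c → b + c ≤ suc a → b ≤ a
m+n≤1+o⇒m≤o {a} {b} {c} p q = +-cancelʳ-≤ 1 b a (≤-trans (+-monoʳ-≤ b p) (≤-trans q (≤-reflexive (+-comm 1 a))))

≡ᵇ0 : ℕ → Bool
≡ᵇ0 zero    = true
≡ᵇ0 (suc _) = false

≡ᵇ0-true : ∀ m → ≡ᵇ0 m ≡ true → m ≡ 0
≡ᵇ0-true zero _ = refl

-- Finite sums

sum-cong : ∀ {N} {f g : Fin N → ℕ} → (∀ i → f i ≡ g i) → sumFin N f ≡ sumFin N g
sum-cong {zero}  h = refl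
sum-cong {suc N} h = cong₂ _+_ (h F.zero) (sum-cong λ i → h (F.suc i))

sum-mono : ∀ {N} {f g : Fin N → ℕ} → (∀ i → f i ≤ g i) → sumFin N f ≤ sumFin N g
sum-mono {zero}  h = z≤n
sum-mono {suc N} h = +-mono-≤ (h F.zero) (sum-mono λ i → h (F.suc i))

+-interchange : ∀ a b c d → (a + b) + (c + d) ≡ (a + c) + (b + d)
+-interchange = solve-∀

*-left-comm : ∀ a b c → a * (b * c) ≡ b * (a * c)
*-left-comm = solve-∀

sum-+ : ∀ N (f g : Fin N → ℕ) → sumFin N (λ i → f i + g i) ≡ sumFin N f + sumFin N g
sum-+ zero    f g = refl
sum-+ (suc N) f g = trans (cong (f F.zero + g F.zero +_) (sum-+ N _ _)) (+-interchange (f F.zero) (g F.zero) _ _)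

sum-*ˡ : ∀ N c (f : Fin N → ℕ) → sumFin N (λ i → c * f i) ≡ c * sumFin N f
sum-*ˡ zero    c f = ≡-sym (*-zeroʳ c)
sum-*ˡ (suc N) c f = trans (cong (c * f F.zero +_) (sum-*ˡ N c _)) (≡-sym (*-distribˡ-+ c (f F.zero) _))

sum-*ʳ : ∀ N c (f : Fin N → ℕ) → sumFin N (λ i → f i * c) ≡ sumFin N f * c
sum-*ʳ N c f = trans (sum-cong λ i → *-comm (f i) c) (trans (sum-*ˡ N c f) (*-comm c _))

sum-zero : ∀ N → sumFin N (λ _ → 0) ≡ 0
sum-zero zero    = refl
sum-zero (suc N) = sum-zero N

sum-one : ∀ N → sumFin N (λ _ → 1) ≡ N
sum-one zero    = refl
sum-one (suc N) = cong suc (sum-one N)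

sum-swap : ∀ N K (f : Fin N → Fin K → ℕ) → sumFin N (λ i → sumFin K (f i)) ≡ sumFin K (λ j → sumFin N (λ i → f i j))
sum-swap zero    K f = ≡-sym (sum-zero K)
sum-swap (suc N) K f = trans (cong (sumFin K (f F.zero) +_) (sum-swap N K _)) (≡-sym (sum-+ K (f F.zero) _))

term≤sum : ∀ {N} (f : Fin N → ℕ) i → f i ≤ sumFin N f
term≤sum f F.zero    = m≤m+n _ _
term≤sum f (F.suc i) = ≤-trans (term≤sum (λ j → f (F.suc j)) i) (m≤n+m _ _)

sum≡0⇒term≡0 : ∀ {N} (f : Fin N → ℕ) → sumFin N f ≡ 0 → ∀ i → f i ≡ 0
sum≡0⇒term≡0 f e i = n≤0⇒n≡0 (≤-trans (term≤sum f i) (≤-reflexive e))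

sum≢0⇒∃ : ∀ {N} (f : Fin N → ℕ) → sumFin N f ≢ 0 → ∃ λ i → f i ≢ 0
sum≢0⇒∃ {zero}  f h = ⊥-elim (h refl)
sum≢0⇒∃ {suc N} f h with f F.zero in eq
... | suc _ = F.zero , λ e → 1+n≢0 (trans (≡-sym eq) e)
... | zero  with sum≢0⇒∃ (λ j → f (F.suc j)) h
...   | i , p = F.suc i , p

-- Replacing all other terms of `f` by the larger ones of `g` isolates a single term. This turns a
-- degree count into a statement about each neighbour.
sum-tight : ∀ {N} {f g : Fin N → ℕ} → (∀ i → f i ≤ g i) → sumFin N g ≤ sumFin N f → ∀ i → g i ≤ f i
sum-tight {suc N} {f} {g} h s F.zero = +-cancelʳ-≤ (sumFin N (λ i → f (F.suc i))) _ _
  (≤-trans (+-monoʳ-≤ (g F.zero) (sum-mono λ i → h (F.suc i))) s)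
sum-tight {suc N} {f} {g} h s (F.suc i) = sum-tight (λ j → h (F.suc j))
  (+-cancelˡ-≤ (f F.zero) _ _ (≤-trans (+-monoˡ-≤ _ (h F.zero)) s)) i

sum≤1 : ∀ {N} (f : Fin N → ℕ) → (∀ i → f i ≤ 1) → (∀ i j → f i ≢ 0 → f j ≢ 0 → i ≡ j) → sumFin N f ≤ 1
sum≤1 {zero}  f b u = z≤n
sum≤1 {suc N} f b u with f F.zero in eq
... | zero  = sum≤1 (λ j → f (F.suc j)) (λ j → b (F.suc j))
                (λ i j p q → suc-injective (u (F.suc i) (F.suc j) p q))
... | suc k = subst (_≤ 1) (≡-sym (trans (cong (suc k +_) rest) (+-identityʳ _))) (subst (_≤ 1) eq (b F.zero))
  where rest : sumFin N (λ j → f (F.suc j)) ≡ 0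
        rest with sumFin N (λ j → f (F.suc j)) in e
        ... | zero = refl
        ... | suc _ with sum≢0⇒∃ (λ j → f (F.suc j)) (λ z → 1+n≢0 (trans (≡-sym e) z))
        ...   | i , p with u F.zero (F.suc i) (λ z → 1+n≢0 (trans (≡-sym eq) z)) p
        ...     | ()

-- Sums over subsets

sumOver : ∀ {N} → Subset N → (Fin N → ℕ) → ℕ
sumOver {N} S f = sumFin N (λ i → ι (S i) * f i)

count : ∀ {N} → Subset N → ℕ
count {N} S = countFin N S

ι*-cong : ∀ {b x y} → (b ≡ true → x ≡ y) → ι b * x ≡ ι b * y
ι*-cong {true}  h = cong (1 *_) (h refl)
ι*-cong {false} h = refl

sumOver-cong : ∀ {N} {S : Subset N} {f g} → (∀ i → i ∈ S → f i ≡ g i) → sumOver S f ≡ sumOver S g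
sumOver-cong {S = S} h = sum-cong λ i → ι*-cong {S i} (h i)

sumOver-const : ∀ {N} (S : Subset N) c → sumOver S (λ _ → c) ≡ count S * c
sumOver-const {N} S c = sum-*ʳ N c _

sumOver-+ : ∀ {N} (S : Subset N) f g → sumOver S (λ i → f i + g i) ≡ sumOver S f + sumOver S g
sumOver-+ {N} S f g = trans (sum-cong λ i → *-distribˡ-+ (ι (S i)) (f i) (g i)) (sum-+ N _ _)

sumOver-*ˡ : ∀ {N} (S : Subset N) c f → sumOver S (λ i → c * f i) ≡ c * sumOver S f
sumOver-*ˡ {N} S c f = trans (sum-cong λ i → *-left-comm (ι (S i)) c (f i)) (sum-*ˡ N c _)

sumOver≡0 : ∀ {N} {S : Subset N} {f} → sumOver S f ≡ 0 → ∀ i → i ∈ S → f i ≡ 0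
sumOver≡0 {S = S} {f} e i p = trans (≡-sym (+-identityʳ (f i)))
  (subst (λ b → ι b * f i ≡ 0) p (sum≡0⇒term≡0 _ e i))

-- An equation between indicator values says at once that P and Q cover S and that they are
-- disjoint, since its left side is at most 1. In this form it sums directly.
_≡_⊎ˢ_ : ∀ {N} → Subset N → Subset N → Subset N → Set
S ≡ P ⊎ˢ Q = ∀ i → ι (S i) ≡ ι (P i) + ι (Q i)

sumOver-⊎ : ∀ {N} {S P Q : Subset N} → S ≡ P ⊎ˢ Q → ∀ f → sumOver S f ≡ sumOver P f + sumOver Q f
sumOver-⊎ {N} {S} {P} {Q} h f =
  trans (sum-cong λ i → trans (cong (_* f i) (h i)) (*-distribʳ-+ (f i) (ι (P i)) (ι (Q i)))) (sum-+ N _ _)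

count-⊎ : ∀ {N} {S P Q : Subset N} → S ≡ P ⊎ˢ Q → count S ≡ count P + count Q
count-⊎ {N} h = trans (sum-cong h) (sum-+ N _ _)

count-mono : ∀ {N} {P Q : Subset N} → (∀ i → i ∈ P → i ∈ Q) → count P ≤ count Q
count-mono h = sum-mono λ i → ι-mono (h i)

∈⇒count>0 : ∀ {N} {S : Subset N} {v} → v ∈ S → 1 ≤ count S
∈⇒count>0 {S = S} {v} p = ≤-trans (≤-reflexive (≡-sym (cong ι p))) (term≤sum (λ i → ι (S i)) v)

count>0⇒∈ : ∀ {N} {S : Subset N} → 1 ≤ count S → ∃ λ v → v ∈ S
count>0⇒∈ {S = S} p with sum≢0⇒∃ (λ i → ι (S i)) (λ e → 1+n≰n (≤-trans p (≤-reflexive e)))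
... | i , q with S i in eq
...   | true  = i , eq
...   | false = ⊥-elim (q refl)

argmin : ∀ {N} (S : Subset N) (f : Fin N → ℕ) → (∀ i → i ∉ S) ⊎ ∃ λ a → a ∈ S × (∀ v → v ∈ S → f a ≤ f v)
argmin {zero}  S f = inj₁ λ ()
argmin {suc N} S f with argmin (λ i → S (F.suc i)) (λ i → f (F.suc i)) | S F.zero in eq
... | inj₁ none        | false = inj₁ λ { F.zero → eq ; (F.suc i) → none i }
... | inj₁ none        | true  = inj₂ (F.zero , eq , λ { F.zero _ → ≤-refl ; (F.suc i) p → ⊥-elim (true≢false p (none i)) })
... | inj₂ (a , p , m) | false = inj₂ (F.suc a , p , λ { F.zero q → ⊥-elim (true≢false q eq) ; (F.suc i) q → m i q })
... | inj₂ (a , p , m) | true with ≤-total (f F.zero) (f (F.suc a))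
...   | inj₁ le = inj₂ (F.zero , eq , λ { F.zero _ → ≤-refl ; (F.suc i) q → ≤-trans le (m i q) })
...   | inj₂ ge = inj₂ (F.suc a , p , λ { F.zero _ → ge ; (F.suc i) q → m i q })

-- Singletons and the handshake lemma

⌊≟⌋-true : ∀ {N} {i j : Fin N} → ⌊ i ≟ j ⌋ ≡ true → i ≡ j
⌊≟⌋-true {i = i} {j} e with i ≟ j
... | yes p = p

⌊≟⌋-refl : ∀ {N} (i : Fin N) → ⌊ i ≟ i ⌋ ≡ true
⌊≟⌋-refl i with i ≟ i
... | yes _ = refl
... | no ¬p = ⊥-elim (¬p refl)

count-singleton : ∀ {N} (a : Fin N) → count (λ i → ⌊ i ≟ a ⌋) ≡ 1
count-singleton a = ≤-antisym
  (sum≤1 _ (λ i → ι≤1 ⌊ i ≟ a ⌋) λ i j p q → trans (pos i p) (≡-sym (pos j q)))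
  (∈⇒count>0 {S = λ i → ⌊ i ≟ a ⌋} (⌊≟⌋-refl a))
  where pos : ∀ i → ι ⌊ i ≟ a ⌋ ≢ 0 → i ≡ a
        pos i p with i ≟ a
        ... | yes e = e
        ... | no _  = ⊥-elim (p refl)

<ᵇ-trichotomy : ∀ a b → a ≢ b → 1 ≡ ι (a <ᵇ b) + ι (b <ᵇ a)
<ᵇ-trichotomy zero    zero    h = ⊥-elim (h refl)
<ᵇ-trichotomy zero    (suc b) h = refl
<ᵇ-trichotomy (suc a) zero    h = refl
<ᵇ-trichotomy (suc a) (suc b) h = <ᵇ-trichotomy a b (λ e → h (cong suc e))

-- Each related ordered pair has its smaller index first or second, never neither, by irreflexivity.
-- Exchanging the two sums turns the second kind into the first.
handshake : ∀ N (r : Fin N → Fin N → Bool) → (∀ i j → r i j ≡ r j i) → (∀ i → r i i ≡ false)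
  → sumFin N (λ i → countFin N (r i)) ≡ 2 * pairCount N r
handshake N r rs ri = begin
  sumFin N (λ i → sumFin N (λ j → ι (r i j)))
    ≡⟨ sum-cong (λ i → sum-cong (split i)) ⟩
  sumFin N (λ i → sumFin N (λ j → up i j + up j i))
    ≡⟨ sum-cong (λ i → sum-+ N (up i) (λ j → up j i)) ⟩
  sumFin N (λ i → sumFin N (up i) + sumFin N (λ j → up j i))
    ≡⟨ sum-+ N (λ i → sumFin N (up i)) _ ⟩
  pairCount N r + sumFin N (λ i → sumFin N (λ j → up j i))
    ≡⟨ cong (pairCount N r +_) (sum-swap N N (λ i j → up j i)) ⟩
  pairCount N r + pairCount N r
    ≡⟨ cong (pairCount N r +_) (≡-sym (+-identityʳ _)) ⟩
  2 * pairCount N r ∎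
  where
  open ≡-Reasoning
  up : Fin N → Fin N → ℕ
  up i j = ι ((toℕ i <ᵇ toℕ j) ∧ r i j)
  split : ∀ i j → ι (r i j) ≡ up i j + up j i
  split i j with r i j in eq | r j i in eq'
  ... | true  | false = ⊥-elim (true≢false eq (trans (rs i j) eq'))
  ... | false | true  = ⊥-elim (true≢false eq' (trans (rs j i) eq))
  ... | false | false rewrite ι-∧ (toℕ i <ᵇ toℕ j) false | ι-∧ (toℕ j <ᵇ toℕ i) false
                            | *-zeroʳ (ι (toℕ i <ᵇ toℕ j)) | *-zeroʳ (ι (toℕ j <ᵇ toℕ i)) = refl
  ... | true  | true  rewrite ι-∧ (toℕ i <ᵇ toℕ j) true | ι-∧ (toℕ j <ᵇ toℕ i) true
                            | *-identityʳ (ι (toℕ i <ᵇ toℕ j)) | *-identityʳ (ι (toℕ j <ᵇ toℕ i)) =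
        <ᵇ-trichotomy (toℕ i) (toℕ j) λ e → true≢false eq (trans (cong (r i) (≡-sym (toℕ-injective e))) (ri i))

-- Matchings obtained by peeling

edge : ∀ {N} → Fin N → Fin N → Fin N → Fin N → Bool
edge a b i j = (⌊ i ≟ a ⌋ ∧ ⌊ j ≟ b ⌋) ∨ (⌊ i ≟ b ⌋ ∧ ⌊ j ≟ a ⌋)

edge-true : ∀ {N} {a b i j : Fin N} → edge a b i j ≡ true → (i ≡ a × j ≡ b) ⊎ (i ≡ b × j ≡ a)
edge-true {a = a} {b} {i} {j} e with ∨-true {⌊ i ≟ a ⌋ ∧ ⌊ j ≟ b ⌋} e
... | inj₁ p = let q , r = ∧-true p in inj₁ (⌊≟⌋-true q , ⌊≟⌋-true r)
... | inj₂ p = let q , r = ∧-true p in inj₂ (⌊≟⌋-true q , ⌊≟⌋-true r)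

edge-ab : ∀ {N} (a b : Fin N) → edge a b a b ≡ true
edge-ab a b = ∨-introˡ _ (∧-intro (⌊≟⌋-refl a) (⌊≟⌋-refl b))

edge-ba : ∀ {N} (a b : Fin N) → edge a b b a ≡ true
edge-ba a b = ∨-introʳ (⌊ b ≟ a ⌋ ∧ ⌊ a ≟ b ⌋) (∧-intro (⌊≟⌋-refl b) (⌊≟⌋-refl a))

edge-sym : ∀ {N} {a b i j : Fin N} → edge a b i j ≡ true → edge a b j i ≡ true
edge-sym {a = a} {b} {i} {j} e with edge-true {i = i} {j} e
... | inj₁ (refl , refl) = edge-ba a b
... | inj₂ (refl , refl) = edge-ab a b

sum-edge : ∀ {N} (a b : Fin N) → a ≢ b → sumFin N (λ i → countFin N (edge a b i)) ≡ 2
sum-edge {N} a b a≢b = begin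
  sumFin N (λ i → sumFin N (λ j → ι (edge a b i j)))
    ≡⟨ sum-cong (λ i → sum-cong (split i)) ⟩
  sumFin N (λ i → sumFin N (λ j → at a i * at b j + at b i * at a j))
    ≡⟨ sum-cong (λ i → trans (sum-+ N _ _) (cong₂ _+_ (inner i a b) (inner i b a))) ⟩
  sumFin N (λ i → at a i + at b i)
    ≡⟨ sum-+ N (at a) (at b) ⟩
  sumFin N (at a) + sumFin N (at b)
    ≡⟨ cong₂ _+_ (count-singleton a) (count-singleton b) ⟩
  2 ∎
  where
  open ≡-Reasoning
  at : Fin N → Fin N → ℕ
  at c i = ι ⌊ i ≟ c ⌋
  inner : ∀ i c d → sumFin N (λ j → at c i * at d j) ≡ at c i
  inner i c d = trans (sum-*ˡ N (at c i) (at d)) (trans (cong (at c i *_) (count-singleton d)) (*-identityʳ _))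
  split : ∀ i j → ι (edge a b i j) ≡ at a i * at b j + at b i * at a j
  split i j = trans
    (ι-∨ (⌊ i ≟ a ⌋ ∧ ⌊ j ≟ b ⌋) (⌊ i ≟ b ⌋ ∧ ⌊ j ≟ a ⌋) disjoint)
    (cong₂ _+_ (ι-∧ ⌊ i ≟ a ⌋ ⌊ j ≟ b ⌋) (ι-∧ ⌊ i ≟ b ⌋ ⌊ j ≟ a ⌋))
    where
    disjoint : ⌊ i ≟ a ⌋ ∧ ⌊ j ≟ b ⌋ ≡ true → ⌊ i ≟ b ⌋ ∧ ⌊ j ≟ a ⌋ ≡ false
    disjoint p with ⌊ i ≟ b ⌋ ∧ ⌊ j ≟ a ⌋ in eq
    ... | false = refl
    ... | true  = ⊥-elim (a≢b (trans (≡-sym (⌊≟⌋-true {i = i} (proj₁ (∧-true p)))) (⌊≟⌋-true {i = i} (proj₁ (∧-true eq)))))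

matching-irrefl : ∀ {G} (μ : Matching G) v → M μ v v ≡ false
matching-irrefl {G} μ v with M μ v v in eq
... | false = refl
... | true  = ⊥-elim (true≢false (M-edge μ v v eq) (irrefl G v))

module _ (G : Graph) where

  private V = Fin (n G)

  adj⇒≢ : ∀ {a b : V} → adj G a b ≡ true → a ≢ b
  adj⇒≢ {a} p refl = true≢false p (irrefl G a)

  -- Keeps the order in which the edges are chosen, because unique restrictedness is proved along
  -- it. The condition on `S′` constrains only the neighbours of `a`; it excludes `b` as well, since
  -- `ab` is an edge.
  data Peeling : Subset (n G) → ℕ → Set where
    done : ∀ {S} → Peeling S 0
    peel : ∀ {S k} (S′ : Subset (n G)) (a b : V)
      → a ∈ S → b ∈ S → adj G a b ≡ true
      → (∀ v → v ∈ S′ → v ∈ S × v ≢ a × adj G a v ≡ false)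
      → Peeling S′ k → Peeling S (suc k)

  rel : ∀ {S k} → Peeling S k → V → V → Bool
  rel done                   i j = false
  rel (peel _ a b _ _ _ _ P) i j = rel P i j ∨ edge a b i j

  rel⊆ : ∀ {S k} (P : Peeling S k) {i j} → rel P i j ≡ true → i ∈ S
  rel⊆ (peel _ a b a∈ b∈ _ S′⊆ P) {i} {j} e with ∨-true {rel P i j} e
  ... | inj₁ r = proj₁ (S′⊆ i (rel⊆ P r))
  ... | inj₂ r with edge-true {i = i} {j} r
  ...   | inj₁ (refl , _) = a∈
  ...   | inj₂ (refl , _) = b∈

  rel-sym : ∀ {S k} (P : Peeling S k) {i j} → rel P i j ≡ true → rel P j i ≡ true
  rel-sym (peel _ a b _ _ _ _ P) {i} {j} e with ∨-true {rel P i j} e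
  ... | inj₁ r = ∨-introˡ _ (rel-sym P r)
  ... | inj₂ r = ∨-introʳ (rel P j i) (edge-sym {i = i} {j} r)

  rel-edge : ∀ {S k} (P : Peeling S k) {i j} → rel P i j ≡ true → adj G i j ≡ true
  rel-edge (peel _ a b _ _ ab _ P) {i} {j} e with ∨-true {rel P i j} e
  ... | inj₁ r = rel-edge P r
  ... | inj₂ r with edge-true {i = i} {j} r
  ...   | inj₁ (refl , refl) = ab
  ...   | inj₂ (refl , refl) = trans (sym G b a) ab

  rel-edge-disjoint : ∀ {S S′ : Subset (n G)} {k} {a b : V} (P : Peeling S′ k) → adj G a b ≡ true
    → (∀ v → v ∈ S′ → v ∈ S × v ≢ a × adj G a v ≡ false)
    → ∀ {i j l} → rel P i j ≡ true → edge a b i l ≡ true → ⊥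
  rel-edge-disjoint P ab S′⊆ {i} {j} {l} r e with S′⊆ i (rel⊆ P r) | edge-true {i = i} {l} e
  ... | _ , i≢a , _ | inj₁ (i≡a , _) = i≢a i≡a
  ... | _ , _ , na  | inj₂ (refl , _) = true≢false ab na

  edge-disj : ∀ {a b i j l : V} → adj G a b ≡ true → edge a b i j ≡ true → edge a b i l ≡ true → j ≡ l
  edge-disj {i = i} {j} {l} ab e e′ with edge-true {i = i} {j} e | edge-true {i = i} {l} e′
  ... | inj₁ (_ , refl)    | inj₁ (_ , refl)    = refl
  ... | inj₂ (_ , refl)    | inj₂ (_ , refl)    = refl
  ... | inj₁ (refl , refl) | inj₂ (i≡b , _) = ⊥-elim (adj⇒≢ ab i≡b)
  ... | inj₂ (refl , refl) | inj₁ (b≡a , _) = ⊥-elim (adj⇒≢ ab (≡-sym b≡a))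

  rel-disj : ∀ {S k} (P : Peeling S k) {i j l} → rel P i j ≡ true → rel P i l ≡ true → j ≡ l
  rel-disj (peel _ a b _ _ ab S′⊆ P) {i} {j} {l} e e′ with ∨-true {rel P i j} e | ∨-true {rel P i l} e′
  ... | inj₁ r | inj₁ r′ = rel-disj P r r′
  ... | inj₂ r | inj₂ r′ = edge-disj {i = i} ab r r′
  ... | inj₁ r | inj₂ r′ = ⊥-elim (rel-edge-disjoint P ab S′⊆ {l = l} r r′)
  ... | inj₂ r | inj₁ r′ = ⊥-elim (rel-edge-disjoint P ab S′⊆ {l = j} r′ r)

  peelingMatching : ∀ {S k} → Peeling S k → Matching G
  peelingMatching P = record
    { M      = rel P
    ; M-sym  = λ i j → bool-ext (rel-sym P) (rel-sym P)
    ; M-edge = λ i j → rel-edge P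
    ; M-disj = λ i j l → rel-disj P
    }

  sum-rel : ∀ {S k} (P : Peeling S k) → sumFin (n G) (λ i → countFin (n G) (rel P i)) ≡ 2 * k
  sum-rel done = trans (sum-cong {n G} λ _ → sum-zero (n G)) (sum-zero (n G))
  sum-rel {k = suc k} (peel _ a b _ _ ab S′⊆ P) = begin
    sumFin (n G) (λ i → countFin (n G) (λ j → rel P i j ∨ edge a b i j))
      ≡⟨ sum-cong (λ i → trans (sum-cong λ j → ι-∨ (rel P i j) (edge a b i j) (disjoint i j)) (sum-+ (n G) _ _)) ⟩
    sumFin (n G) (λ i → countFin (n G) (rel P i) + countFin (n G) (edge a b i))
      ≡⟨ sum-+ (n G) _ _ ⟩
    sumFin (n G) (λ i → countFin (n G) (rel P i)) + sumFin (n G) (λ i → countFin (n G) (edge a b i))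
      ≡⟨ cong₂ _+_ (sum-rel P) (sum-edge a b (adj⇒≢ ab)) ⟩
    2 * k + 2
      ≡⟨ arith k ⟩
    2 * suc k ∎
    where
    open ≡-Reasoning
    arith : ∀ k → 2 * k + 2 ≡ 2 * suc k
    arith = solve-∀
    disjoint : ∀ i j → rel P i j ≡ true → edge a b i j ≡ false
    disjoint i j r with edge a b i j in eq
    ... | false = refl
    ... | true  = ⊥-elim (rel-edge-disjoint P ab S′⊆ {l = j} r eq)

  matching-handshake : (μ : Matching G) → sumFin (n G) (λ i → countFin (n G) (M μ i)) ≡ 2 * size μ
  matching-handshake μ = handshake (n G) (M μ) (M-sym μ) (matching-irrefl μ)

  peelingMatching-size : ∀ {S k} (P : Peeling S k) → size (peelingMatching P) ≡ k
  peelingMatching-size P = *-cancelˡ-≡ _ _ 2 (trans (≡-sym (matching-handshake (peelingMatching P))) (sum-rel P))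

  -- The vertex a of the first edge ab has no neighbour but b among the covered vertices, so every
  -- matching with the same covered vertices contains ab.
  peelingMatching-forced : ∀ {S k} (P : Peeling S k) (μ : Matching G)
    → (∀ v → Covered (peelingMatching P) v → Covered μ v)
    → (∀ v u → v ∈ S → M μ v u ≡ true → Covered (peelingMatching P) u)
    → ∀ i j → rel P i j ≡ true → M μ i j ≡ true
  peelingMatching-forced (peel {S} S′ a b a∈ b∈ ab S′⊆ P) μ cov closed = forced
    where
    Q = peel {S = S} S′ a b a∈ b∈ ab S′⊆ P
    cases : ∀ u → Covered (peelingMatching Q) u → Covered (peelingMatching P) u ⊎ (u ≡ a ⊎ u ≡ b)
    cases u (w , e) with ∨-true {rel P u w} e
    ... | inj₁ r = inj₁ (w , r)
    ... | inj₂ r with edge-true {i = u} {w} r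
    ...   | inj₁ (p , _) = inj₂ (inj₁ p)
    ...   | inj₂ (p , _) = inj₂ (inj₂ p)
    ab∈μ : M μ a b ≡ true
    ab∈μ with cov a (b , ∨-introʳ (rel P a b) (edge-ab a b))
    ... | u , e with cases u (closed a u a∈ e)
    ...   | inj₂ (inj₂ refl) = e
    ...   | inj₂ (inj₁ refl) = ⊥-elim (true≢false e (matching-irrefl μ a))
    ...   | inj₁ (w , r) = ⊥-elim (true≢false (M-edge μ a u e) (proj₂ (proj₂ (S′⊆ u (rel⊆ P r)))))
    -- Further down the recursion `μ` still contains the earlier edges, so equality of covered sets
    -- is not inherited; the two one-sided hypotheses are. Here `a` and `b` are already matched to
    -- each other, hence neither is the partner of a vertex of `S′`.
    closed′ : ∀ v u → v ∈ S′ → M μ v u ≡ true → Covered (peelingMatching P) u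
    closed′ v u v∈ e with S′⊆ v v∈
    ... | v∈S , v≢a , na with cases u (closed v u v∈S e)
    ...   | inj₁ c = c
    ...   | inj₂ (inj₁ refl) = ⊥-elim (true≢false ab (subst (λ x → adj G a x ≡ false)
                                 (M-disj μ a v b (trans (M-sym μ a v) e) ab∈μ) na))
    ...   | inj₂ (inj₂ refl) = ⊥-elim (v≢a (M-disj μ b v a (trans (M-sym μ b v) e) (trans (M-sym μ b a) ab∈μ)))
    forced : ∀ i j → rel Q i j ≡ true → M μ i j ≡ true
    forced i j e with ∨-true {rel P i j} e
    ... | inj₁ r = peelingMatching-forced P μ (λ v (w , c) → cov v (w , ∨-introˡ _ c)) closed′ i j r
    ... | inj₂ r with edge-true {i = i} {j} r
    ...   | inj₁ (refl , refl) = ab∈μ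
    ...   | inj₂ (refl , refl) = trans (M-sym μ b a) ab∈μ

  peelingMatching-UR : ∀ {S k} (P : Peeling S k) → UniquelyRestricted (peelingMatching P)
  peelingMatching-UR P μ same i j = bool-ext (forced i j) back
    where
    forced : ∀ i j → rel P i j ≡ true → M μ i j ≡ true
    forced = peelingMatching-forced P μ (λ v → Equivalence.to (same v))
      (λ v u _ e → Equivalence.from (same u) (v , trans (M-sym μ u v) e))
    back : M μ i j ≡ true → rel P i j ≡ true
    back e with Equivalence.from (same i) (j , e)
    ... | u , r = subst (λ x → rel P i x ≡ true) (M-disj μ i u j (forced i u r) e) r

-- The greedy argument

-- With p = Δ − t and q = Δ − d, a step removing t + d vertices and t d edges gains the slack 2 p q.
step-balance : ∀ t p d q s k z e x Δ → Δ ≡ t + p → Δ ≡ d + q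
  → 2 * (Δ * s) + z ≡ 2 * (Δ * Δ * k) + e
  → 2 * (Δ * (s + t + d)) + (z + 2 * (p * q) + x) ≡ 2 * (Δ * Δ * suc k) + (e + 2 * (t * d) + x)
step-balance t p d q s k z e x Δ h₁ h₂ h = begin
  2 * (Δ * (s + t + d)) + (z + 2 * (p * q) + x)
    ≡⟨ arith₁ t p d q s z x Δ ⟩
  (2 * (Δ * s) + z) + (2 * (Δ * t + Δ * d + p * q) + x)
    ≡⟨ cong₂ (λ u w → u + (2 * w + x)) h key ⟩
  (2 * (Δ * Δ * k) + e) + (2 * (Δ * Δ + t * d) + x)
    ≡⟨ arith₂ t d k e x Δ ⟩
  2 * (Δ * Δ * suc k) + (e + 2 * (t * d) + x) ∎
  where
  open ≡-Reasoning
  arith₁ : ∀ t p d q s z x Δ → 2 * (Δ * (s + t + d)) + (z + 2 * (p * q) + x)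
    ≡ (2 * (Δ * s) + z) + (2 * (Δ * t + Δ * d + p * q) + x)
  arith₁ = solve-∀
  arith₂ : ∀ t d k e x Δ → (2 * (Δ * Δ * k) + e) + (2 * (Δ * Δ + t * d) + x)
    ≡ 2 * (Δ * Δ * suc k) + (e + 2 * (t * d) + x)
  arith₂ = solve-∀
  arith₃ : ∀ t p d q → (d + q) * t + (t + p) * d + p * q ≡ (t + p) * (d + q) + t * d
  arith₃ = solve-∀
  -- The identity Δt + Δd - td = Δ² - pq, written without subtraction.
  key : Δ * t + Δ * d + p * q ≡ Δ * Δ + t * d
  key = trans (cong₂ (λ u w → u * t + w * d + p * q) h₂ h₁)
    (trans (arith₃ t p d q) (cong₂ (λ u w → u * w + t * d) (≡-sym h₁) (≡-sym h₂)))

module _ (G : Graph) where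

  private V = Fin (n G)

  -- The two sides of a complete bipartite component of the subgraph induced by S.
  record Block (Δ : ℕ) (S : Subset (n G)) (v : V) : Set where
    field
      A B      : Subset (n G)
      ∣A∣≡Δ    : count A ≡ Δ
      1≤∣B∣    : 1 ≤ count B
      ∣B∣≤Δ    : count B ≤ Δ
      v∈A∪B    : v ∈ A ⊎ v ∈ B
      A⊆S      : ∀ x → x ∈ A → x ∈ S
      B⊆S      : ∀ x → x ∈ B → x ∈ S
      adj-A    : ∀ x y → x ∈ A → y ∈ S → adj G x y ≡ B y
      adj-B    : ∀ x y → x ∈ B → y ∈ S → adj G x y ≡ A y

  degIn : Subset (n G) → V → ℕ
  degIn Q v = sumOver Q (λ u → ι (adj G v u))

  -- Ordered pairs are counted, so `arcs S S` is twice the number of edges inside S, while an edge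
  -- between disjoint sets counts once.
  arcs : Subset (n G) → Subset (n G) → ℕ
  arcs P Q = sumOver P (degIn Q)

  arcs-sym : ∀ P Q → arcs P Q ≡ arcs Q P
  arcs-sym P Q = begin
    sumFin (n G) (λ i → ι (P i) * sumFin (n G) (λ j → ι (Q j) * ι (adj G i j)))
      ≡⟨ sum-cong (λ i → ≡-sym (sum-*ˡ (n G) (ι (P i)) _)) ⟩
    sumFin (n G) (λ i → sumFin (n G) (λ j → ι (P i) * (ι (Q j) * ι (adj G i j))))
      ≡⟨ sum-swap (n G) (n G) _ ⟩
    sumFin (n G) (λ j → sumFin (n G) (λ i → ι (P i) * (ι (Q j) * ι (adj G i j))))
      ≡⟨ sum-cong (λ j → sum-cong λ i → trans (*-left-comm (ι (P i)) (ι (Q j)) _)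
           (cong (λ b → ι (Q j) * (ι (P i) * ι b)) (sym G i j))) ⟩
    sumFin (n G) (λ j → sumFin (n G) (λ i → ι (Q j) * (ι (P i) * ι (adj G j i))))
      ≡⟨ sum-cong (λ j → sum-*ˡ (n G) (ι (Q j)) _) ⟩
    sumFin (n G) (λ j → ι (Q j) * sumFin (n G) (λ i → ι (P i) * ι (adj G j i))) ∎
    where open ≡-Reasoning

  arcs-⊎ˡ : ∀ {S P Q} T → S ≡ P ⊎ˢ Q → arcs S T ≡ arcs P T + arcs Q T
  arcs-⊎ˡ {S} {P} {Q} T h = sumOver-⊎ {S = S} {P} {Q} h (degIn T)

  arcs-⊎ʳ : ∀ {S P Q} T → S ≡ P ⊎ˢ Q → arcs T S ≡ arcs T P + arcs T Q
  arcs-⊎ʳ {S} {P} {Q} T h = trans (arcs-sym T S)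
    (trans (arcs-⊎ˡ {S} {P} {Q} T h) (cong₂ _+_ (arcs-sym P T) (arcs-sym Q T)))

  degIn≡0 : ∀ {Q v} → degIn Q v ≡ 0 → ∀ u → u ∈ Q → adj G v u ≡ false
  degIn≡0 {Q} {v} e u u∈ = ι≡0 (sumOver≡0 {S = Q} e u u∈)

  arcs≡0 : ∀ {P Q} → arcs P Q ≡ 0 → ∀ x y → x ∈ P → y ∈ Q → adj G x y ≡ false
  arcs≡0 {P} {Q} e x y x∈ y∈ = degIn≡0 {Q} (sumOver≡0 {S = P} e x x∈) y y∈

  no-arcs : ∀ {P Q} → (∀ x y → x ∈ P → y ∈ Q → adj G x y ≡ false) → arcs P Q ≡ 0
  no-arcs {P} {Q} h = trans (sumOver-cong {S = P} λ x x∈ →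
      trans (sumOver-cong {S = Q} λ y y∈ → cong ι (h x y x∈ y∈)) (trans (sumOver-const Q 0) (*-zeroʳ (count Q))))
    (trans (sumOver-const P 0) (*-zeroʳ (count P)))

  NoIsolated : Subset (n G) → Set
  NoIsolated S = ∀ v → v ∈ S → ∃ λ u → u ∈ S × adj G v u ≡ true

  module GreedyStep (Δ : ℕ) (deg≤Δ : ∀ v → degree G v ≤ Δ) (S : Subset (n G)) (noIso : NoIsolated S)
                    (a : V) (a∈S : a ∈ S) (minimal : ∀ v → v ∈ S → degIn S a ≤ degIn S v) where

    B S₀ A S′ : Subset (n G)
    B v  = S v ∧ adj G a v
    S₀ v = S v ∧ not (adj G a v)
    A v  = S₀ v ∧ ≡ᵇ0 (degIn S₀ v)
    S′ v = S₀ v ∧ not (≡ᵇ0 (degIn S₀ v))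

    S≡S₀⊎B : S ≡ S₀ ⊎ˢ B
    S≡S₀⊎B v = ι-split (S v) (adj G a v)

    S₀≡S′⊎A : S₀ ≡ S′ ⊎ˢ A
    S₀≡S′⊎A v = ι-split (S₀ v) (≡ᵇ0 (degIn S₀ v))

    B⊆S : ∀ v → v ∈ B → v ∈ S
    B⊆S v e = proj₁ (∧-true e)

    S₀⊆S : ∀ v → v ∈ S₀ → v ∈ S
    S₀⊆S v e = proj₁ (∧-true e)

    A⊆S₀ : ∀ v → v ∈ A → v ∈ S₀
    A⊆S₀ v e = proj₁ (∧-true e)

    S′⊆S₀ : ∀ v → v ∈ S′ → v ∈ S₀
    S′⊆S₀ v e = proj₁ (∧-true e)

    S₀∩B : ∀ v → v ∈ S₀ → v ∉ B
    S₀∩B v e with S v | adj G a v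
    ... | true | false = refl

    S′∩A : ∀ v → v ∈ S′ → v ∉ A
    S′∩A v e with S₀ v | ≡ᵇ0 (degIn S₀ v)
    ... | true | false = refl

    cover : ∀ v → v ∈ S → v ∈ S′ ⊎ (v ∈ A ⊎ v ∈ B)
    cover v e with adj G a v
    ... | true = inj₂ (inj₂ (∧-intro e refl))
    ... | false with ≡ᵇ0 (degIn S₀ v)
    ...   | true  = inj₂ (inj₁ (∧-intro (∧-intro e refl) refl))
    ...   | false = inj₁ (∧-intro (∧-intro e refl) refl)

    A-isolated : ∀ x → x ∈ A → degIn S₀ x ≡ 0
    A-isolated x e = ≡ᵇ0-true _ (proj₂ (∧-true {S₀ x} e))

    ∣B∣≡degIn : count B ≡ degIn S a
    ∣B∣≡degIn = sum-cong λ v → ι-∧ (S v) (adj G a v)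

    A-degree : ∀ x → x ∈ A → count B ≤ degIn B x
    A-degree x e = ≤-trans (≤-reflexive ∣B∣≡degIn) (≤-trans (minimal x (S₀⊆S x (A⊆S₀ x e)))
      (≤-reflexive (trans (sumOver-⊎ {S = S} {S₀} {B} S≡S₀⊎B (λ u → ι (adj G x u)))
        (cong (_+ degIn B x) (A-isolated x e)))))

    -- All neighbours of x within S lie in B, and by minimality there are at least |B| of them, so
    -- every vertex of B is one.
    A-complete : ∀ x y → x ∈ A → y ∈ B → adj G x y ≡ true
    A-complete x y x∈ y∈ = from-ι (subst (λ b → ι b ≤ ι b * ι (adj G x y)) y∈
        (sum-tight bound (A-degree x x∈) y))
      where
      bound : ∀ i → ι (B i) * ι (adj G x i) ≤ ι (B i)
      bound i = ≤-trans (*-monoʳ-≤ (ι (B i)) (ι≤1 (adj G x i))) (≤-reflexive (*-identityʳ _))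
      from-ι : ∀ {b} → 1 ≤ 1 * ι b → b ≡ true
      from-ι {true} _ = refl

    A-adj : ∀ x y → x ∈ A → y ∈ S → adj G x y ≡ B y
    A-adj x y x∈ y∈ with adj G a y in eq
    ... | true  = trans (A-complete x y x∈ (∧-intro y∈ eq)) (≡-sym (∧-intro y∈ refl))
    ... | false = trans (degIn≡0 {S₀} (A-isolated x x∈) y (∧-intro y∈ (cong not eq)))
                    (≡-sym (∧-zeroʳ (S y)))

    b₀ : V
    b₀ = proj₁ (noIso a a∈S)

    b₀∈S : b₀ ∈ S
    b₀∈S = proj₁ (proj₂ (noIso a a∈S))

    ab₀ : adj G a b₀ ≡ true
    ab₀ = proj₂ (proj₂ (noIso a a∈S))

    b₀∈B : b₀ ∈ B
    b₀∈B = ∧-intro b₀∈S ab₀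

    1≤∣B∣ : 1 ≤ count B
    1≤∣B∣ = ∈⇒count>0 {S = B} b₀∈B

    ∣B∣≤Δ : count B ≤ Δ
    ∣B∣≤Δ = ≤-trans (count-mono {P = B} {adj G a} λ v e → proj₂ (∧-true {S v} e)) (deg≤Δ a)

    ∣A∣≤Δ : count A ≤ Δ
    ∣A∣≤Δ = ≤-trans (count-mono {P = A} {adj G b₀} λ x e → trans (sym G b₀ x) (A-complete x b₀ e b₀∈B)) (deg≤Δ b₀)

    arcs-AB : arcs A B ≡ count A * count B
    arcs-AB = trans (sumOver-cong {S = A} λ x e →
        sum-cong λ y → full x y e) (sumOver-const A (count B))
      where
      full : ∀ x y → x ∈ A → ι (B y) * ι (adj G x y) ≡ ι (B y)
      full x y x∈ = trans (ι*-cong {B y} λ y∈ → cong ι (A-complete x y x∈ y∈)) (*-identityʳ _)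

    ∣S∣ : count S ≡ count S′ + count A + count B
    ∣S∣ = trans (count-⊎ {S = S} {S₀} {B} S≡S₀⊎B) (cong (_+ count B) (count-⊎ {S = S₀} {S′} {A} S₀≡S′⊎A))

    arcs-AS₀ : arcs A S₀ ≡ 0
    arcs-AS₀ = no-arcs {A} {S₀} λ x y x∈ → degIn≡0 {S₀} (A-isolated x x∈) y

    arcs-S′A : arcs S′ A ≡ 0
    arcs-S′A = trans (arcs-sym S′ A)
      (no-arcs {A} {S′} λ x y x∈ y∈ → degIn≡0 {S₀} (A-isolated x x∈) y (S′⊆S₀ y y∈))

    -- Vertices of A have neighbours only in B. Outside the remaining set, the edges are therefore
    -- the |A||B| ones between A and B, those between the remaining set and B, and those inside B.
    arcs-SS : arcs S S ≡ arcs S′ S′ + 2 * (count A * count B) + (2 * arcs S′ B + arcs B B)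
    arcs-SS = begin
      arcs S S
        ≡⟨ arcs-⊎ˡ {S} {S₀} {B} S S≡S₀⊎B ⟩
      arcs S₀ S + arcs B S
        ≡⟨ cong₂ _+_ (arcs-⊎ʳ {S} {S₀} {B} S₀ S≡S₀⊎B) (arcs-⊎ʳ {S} {S₀} {B} B S≡S₀⊎B) ⟩
      (arcs S₀ S₀ + arcs S₀ B) + (arcs B S₀ + arcs B B)
        ≡⟨ cong (λ x → (arcs S₀ S₀ + arcs S₀ B) + (x + arcs B B)) (arcs-sym B S₀) ⟩
      (arcs S₀ S₀ + arcs S₀ B) + (arcs S₀ B + arcs B B)
        ≡⟨ cong₂ (λ x y → (x + y) + (y + arcs B B)) inner (trans (arcs-⊎ˡ {S₀} {S′} {A} B S₀≡S′⊎A) (cong (arcs S′ B +_) arcs-AB)) ⟩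
      (arcs S′ S′ + (arcs S′ B + count A * count B)) + ((arcs S′ B + count A * count B) + arcs B B)
        ≡⟨ arith (arcs S′ S′) (arcs S′ B) (count A * count B) (arcs B B) ⟩
      arcs S′ S′ + 2 * (count A * count B) + (2 * arcs S′ B + arcs B B) ∎
      where
      open ≡-Reasoning
      arith : ∀ e x c y → (e + (x + c)) + ((x + c) + y) ≡ e + 2 * c + (2 * x + y)
      arith = solve-∀
      inner : arcs S₀ S₀ ≡ arcs S′ S′
      inner = trans (arcs-⊎ˡ {S₀} {S′} {A} S₀ S₀≡S′⊎A) (trans (cong₂ _+_
        (trans (arcs-⊎ʳ {S₀} {S′} {A} S′ S₀≡S′⊎A) (trans (cong (arcs S′ S′ +_) arcs-S′A) (+-identityʳ _)))
        arcs-AS₀) (+-identityʳ _))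

    -- A vertex that survives has a neighbour u in `S₀`, and this edge in turn keeps u from being
    -- isolated there, so u survives too.
    noIso′ : NoIsolated S′
    noIso′ v v∈ with sum≢0⇒∃ (λ u → ι (S₀ u) * ι (adj G v u)) pos
      where
      pos : degIn S₀ v ≢ 0
      pos e with proj₂ (∧-true {S₀ v} v∈)
      ... | q rewrite e with q
      ...   | ()
    ... | u , h with S₀ u in u∈ | adj G v u in vu
    ...   | false | _     = ⊥-elim (h refl)
    ...   | true  | false = ⊥-elim (h refl)
    ...   | true  | true  = u , ∧-intro u∈ nonzero , vu
      where
      nonzero : not (≡ᵇ0 (degIn S₀ u)) ≡ true
      nonzero with ≡ᵇ0 (degIn S₀ u) in eq
      ... | false = refl
      ... | true  = ⊥-elim (true≢false (trans (sym G u v) vu) (degIn≡0 {S₀} (≡ᵇ0-true _ eq) v (S′⊆S₀ v v∈)))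

    S′-avoids : ∀ v → v ∈ S′ → v ∈ S × v ≢ a × adj G a v ≡ false
    S′-avoids v v∈ = S₀⊆S v v∈S₀ , v≢a , av
      where
      v∈S₀ = S′⊆S₀ v v∈
      av = not-true (proj₂ (∧-true {S v} v∈S₀))
      -- All neighbours of `a` in S are in B, so `a` is isolated in `S₀`, whereas vertices of `S′`
      -- have neighbours in `S′`.
      v≢a : v ≢ a
      v≢a refl with noIso′ v v∈
      ... | u , u∈ , vu = true≢false vu (not-true (proj₂ (∧-true {S u} (S′⊆S₀ u u∈))))

    module Tight (x≡0 : 2 * arcs S′ B + arcs B B ≡ 0) (full : count A ≡ Δ ⊎ count B ≡ Δ) where

      no-S′B : ∀ x y → x ∈ S′ → y ∈ B → adj G x y ≡ false
      no-S′B = arcs≡0 {S′} {B} (m+n≡0⇒m≡0 (arcs S′ B) (m+n≡0⇒m≡0 (2 * arcs S′ B) x≡0))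

      no-BB : ∀ x y → x ∈ B → y ∈ B → adj G x y ≡ false
      no-BB = arcs≡0 {B} {B} (m+n≡0⇒n≡0 (2 * arcs S′ B) x≡0)

      B-adj : ∀ x y → x ∈ B → y ∈ S → adj G x y ≡ A y
      B-adj x y x∈ y∈ with cover y y∈
      ... | inj₁ y∈S′        = trans (trans (sym G x y) (no-S′B y x y∈S′ x∈)) (≡-sym (S′∩A y y∈S′))
      ... | inj₂ (inj₁ y∈A)  = trans (trans (sym G x y) (A-complete y x y∈A x∈)) (≡-sym y∈A)
      ... | inj₂ (inj₂ y∈B)  = trans (no-BB x y x∈ y∈B) (≡-sym y∉A)
        where
        y∉A : A y ≡ false
        y∉A with A y in eq
        ... | false = refl
        ... | true  = ⊥-elim (true≢false y∈B (S₀∩B y (A⊆S₀ y eq)))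

      -- If |B| = Δ, then G[S] is Δ-regular, and all neighbours of b₀ in S lie in A.
      ∣A∣≡Δ : count A ≡ Δ
      ∣A∣≡Δ = [ (λ e → e) , from-∣B∣ ]′ full
        where
        bound : ∀ y → ι (S y) * ι (adj G b₀ y) ≤ ι (A y)
        bound y = ≤-trans (≤-reflexive (ι*-cong {S y} λ y∈ → cong ι (B-adj b₀ y b₀∈B y∈)))
          (≤-trans (*-monoˡ-≤ (ι (A y)) (ι≤1 (S y))) (≤-reflexive (*-identityˡ _)))
        from-∣B∣ : count B ≡ Δ → count A ≡ Δ
        from-∣B∣ e = ≤-antisym ∣A∣≤Δ (≤-trans (≤-reflexive (trans (≡-sym e) ∣B∣≡degIn))
          (≤-trans (minimal b₀ b₀∈S) (sum-mono bound)))

      block : ∀ v → v ∈ A ⊎ v ∈ B → Block Δ S v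
      block v v∈ = record
        { A = A ; B = B ; ∣A∣≡Δ = ∣A∣≡Δ ; 1≤∣B∣ = 1≤∣B∣ ; ∣B∣≤Δ = ∣B∣≤Δ ; v∈A∪B = v∈
        ; A⊆S = λ x e → S₀⊆S x (A⊆S₀ x e) ; B⊆S = B⊆S ; adj-A = A-adj ; adj-B = B-adj }

      separated : ∀ x y → x ∈ S′ → y ∈ S → y ∉ S′ → adj G x y ≡ false
      separated x y x∈ y∈ y∉ with cover y y∈
      ... | inj₁ y∈S′       = ⊥-elim (true≢false y∈S′ y∉)
      ... | inj₂ (inj₁ y∈A) = trans (sym G x y) (degIn≡0 {S₀} (A-isolated y y∈A) x (S′⊆S₀ x x∈))
      ... | inj₂ (inj₂ y∈B) = no-S′B x y x∈ y∈B

      -- The adjacency conditions now range over all of S. For y outside `S′` both sides are false: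
      -- `separated` excludes the edge, and the sides of the block lie in `S′`.
      extend : ∀ {v} → Block Δ S′ v → Block Δ S v
      extend blk = record
        { A = A′ ; B = B′ ; ∣A∣≡Δ = ∣A∣≡Δ′ ; 1≤∣B∣ = 1≤∣B∣′ ; ∣B∣≤Δ = ∣B∣≤Δ′ ; v∈A∪B = v∈A∪B
        ; A⊆S = λ x e → S′⊆S x (A′⊆S′ x e) ; B⊆S = λ x e → S′⊆S x (B′⊆S′ x e)
        ; adj-A = λ x y x∈ → lift x y (A′⊆S′ x x∈) B′ B′⊆S′ (adj-A x y x∈)
        ; adj-B = λ x y x∈ → lift x y (B′⊆S′ x x∈) A′ A′⊆S′ (adj-B x y x∈) }
        where
        open Block blk using (v∈A∪B; adj-A; adj-B) renaming (A to A′; B to B′; ∣A∣≡Δ to ∣A∣≡Δ′; 1≤∣B∣ to 1≤∣B∣′; ∣B∣≤Δ to ∣B∣≤Δ′; A⊆S to A′⊆S′; B⊆S to B′⊆S′)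
        S′⊆S : ∀ x → x ∈ S′ → x ∈ S
        S′⊆S x e = S₀⊆S x (S′⊆S₀ x e)
        lift : ∀ x y → x ∈ S′ → (T : Subset (n G)) → (∀ z → z ∈ T → z ∈ S′)
          → (y ∈ S′ → adj G x y ≡ T y) → y ∈ S → adj G x y ≡ T y
        lift x y x∈ T T⊆ h y∈ with S′ y in eq
        ... | true  = h refl
        ... | false with T y in eq′
        ...   | false = separated x y x∈ y∈ eq
        ...   | true  = ⊥-elim (true≢false (T⊆ y eq′) eq)

      blocks : (∀ v → v ∈ S′ → Block Δ S′ v) → ∀ v → v ∈ S → Block Δ S v
      blocks rest v v∈ with cover v v∈
      ... | inj₁ v∈S′ = extend (rest v v∈S′)
      ... | inj₂ v∈AB = block v v∈AB

  -- An equation with explicit slack instead of an inequality, so that vanishing slack can be passed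
  -- down to every step and `tight` can be proved in the same recursion.
  record GreedyResult (Δ : ℕ) (S : Subset (n G)) : Set where
    field
      number slack : ℕ
      peeling      : Peeling G S number
      balance      : 2 * (Δ * count S) + slack ≡ 2 * (Δ * Δ * number) + arcs S S
      tight        : slack ≡ 0 → ∀ v → v ∈ S → Block Δ S v

  greedy : ∀ Δ → (∀ v → degree G v ≤ Δ) → ∀ bound S → count S ≤ bound → NoIsolated S → GreedyResult Δ S
  greedy Δ deg≤Δ bound S le noIso with argmin S (degIn S)
  ... | inj₁ none = record
    { number = 0 ; slack = 0 ; peeling = done
    ; balance = trans (+-identityʳ _) (trans (cong (λ c → 2 * (Δ * c)) empty)
        (trans (cong (2 *_) (*-zeroʳ Δ)) (≡-sym (cong₂ (λ u w → 2 * u + w) (*-zeroʳ (Δ * Δ))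
          (no-arcs {S} {S} λ x y x∈ → ⊥-elim (true≢false x∈ (none x)))))))
    ; tight = λ _ v v∈ → ⊥-elim (true≢false v∈ (none v)) }
    where
    empty : count S ≡ 0
    empty = trans (sum-cong {n G} λ v → cong ι (none v)) (sum-zero (n G))
  greedy Δ deg≤Δ zero S le noIso | inj₂ (a , a∈S , minimal) =
    ⊥-elim (1+n≰n (≤-trans (∈⇒count>0 {S = S} a∈S) le))
  greedy Δ deg≤Δ (suc bound) S le noIso | inj₂ (a , a∈S , minimal) = record
    -- The term p q measures how far the two sides fall short of Δ; x counts, in both directions,
    -- the removed edges that do not join A to B.
    { number = suc number ; slack = slack + 2 * (p * q) + x
    ; peeling = peel S′ a b₀ a∈S b₀∈S ab₀ S′-avoids peeling
    ; balance = trans (cong (λ c → 2 * (Δ * c) + (slack + 2 * (p * q) + x)) ∣S∣)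
        (trans (step-balance (count A) p (count B) q (count S′) number slack (arcs S′ S′) x Δ
                 (≡-sym (m+[n∸m]≡n ∣A∣≤Δ)) (≡-sym (m+[n∸m]≡n ∣B∣≤Δ)) balance)
          (cong (2 * (Δ * Δ * suc number) +_) (≡-sym arcs-SS)))
    ; tight = λ e → Tight.blocks (m+n≡0⇒n≡0 (slack + 2 * (p * q)) e) (full (pq≡0 e))
        (tight (m+n≡0⇒m≡0 slack (m+n≡0⇒m≡0 (slack + 2 * (p * q)) e))) }
    where
    open GreedyStep Δ deg≤Δ S noIso a a∈S minimal
    p = Δ ∸ count A
    q = Δ ∸ count B
    x = 2 * arcs S′ B + arcs B B
    smaller : count S′ ≤ bound
    smaller = ≤-trans (m≤m+n (count S′) (count A)) (m+n≤1+o⇒m≤o 1≤∣B∣ (≤-trans (≤-reflexive (≡-sym ∣S∣)) le))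
    open GreedyResult (greedy Δ deg≤Δ bound S′ smaller noIso′)
    pq≡0 : slack + 2 * (p * q) + x ≡ 0 → p * q ≡ 0
    pq≡0 e = m+n≡0⇒m≡0 (p * q) (m+n≡0⇒n≡0 slack (m+n≡0⇒m≡0 (slack + 2 * (p * q)) e))
    full : p * q ≡ 0 → count A ≡ Δ ⊎ count B ≡ Δ
    full e with m*n≡0⇒m≡0∨n≡0 p e
    ... | inj₁ p≡0 = inj₁ (≤-antisym ∣A∣≤Δ (m∸n≡0⇒m≤n p≡0))
    ... | inj₂ q≡0 = inj₂ (≤-antisym ∣B∣≤Δ (m∸n≡0⇒m≤n q≡0))

-- Twins in uniquely restricted matchings

transpose-cases : ∀ {N} (u w v : Fin N)
  → (v ≡ u × transpose u w v ≡ w) ⊎ ((v ≡ w × transpose u w v ≡ u) ⊎ (v ≢ u × v ≢ w × transpose u w v ≡ v))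
transpose-cases u w v with v ≟ u
... | yes p = inj₁ (p , refl)
... | no ¬p with v ≟ w
...   | yes q = inj₂ (inj₁ (q , refl))
...   | no ¬q = inj₂ (inj₂ (¬p , ¬q , refl))

module _ {G : Graph} (μ : Matching G) where

  private V = Fin (n G)

  -- Exchanging the twins is an automorphism of G that preserves the covered set when both are
  -- covered. Unique restrictedness makes `μ` invariant under it, so the partner x of u is also the
  -- partner of w.
  twins-not-both-covered : UniquelyRestricted μ → ∀ u w → (∀ y → adj G u y ≡ adj G w y)
    → Covered μ u → Covered μ w → u ≡ w
  twins-not-both-covered ur u w twins (x , ux) cw with u ≟ w
  ... | yes e   = e
  ... | no u≢w = M-disj μ x u w (trans (M-sym μ x u) ux) (trans (M-sym μ x w) wx)
    where
    σ τ : V → V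
    σ = transpose u w
    τ = transpose w u
    adj-σ : ∀ i y → adj G (σ i) y ≡ adj G i y
    adj-σ i y with transpose-cases u w i
    ... | inj₁ (refl , e)             = trans (cong (λ z → adj G z y) e) (≡-sym (twins y))
    ... | inj₂ (inj₁ (refl , e))      = trans (cong (λ z → adj G z y) e) (twins y)
    ... | inj₂ (inj₂ (_ , _ , e))     = cong (λ z → adj G z y) e
    adj-σσ : ∀ i j → adj G (σ i) (σ j) ≡ adj G i j
    adj-σσ i j = trans (adj-σ i (σ j)) (trans (sym G i (σ j)) (trans (adj-σ j i) (sym G j i)))
    μσ : Matching G
    μσ = record
      { M      = λ i j → M μ (σ i) (σ j)
      ; M-sym  = λ i j → M-sym μ (σ i) (σ j)
      ; M-edge = λ i j e → trans (≡-sym (adj-σσ i j)) (M-edge μ (σ i) (σ j) e)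
      ; M-disj = λ i j k p q → trans (≡-sym (transpose-inverse w u))
          (trans (cong τ (M-disj μ (σ i) (σ j) (σ k) p q)) (transpose-inverse w u))
      }
    covered-σ : ∀ v → Covered μ v ⇔ Covered μ (σ v)
    covered-σ v with transpose-cases u w v
    ... | inj₁ (refl , e)         = mk⇔ (λ _ → subst (Covered μ) (≡-sym e) cw) (λ _ → x , ux)
    ... | inj₂ (inj₁ (refl , e))  = mk⇔ (λ _ → subst (Covered μ) (≡-sym e) (x , ux)) (λ _ → cw)
    ... | inj₂ (inj₂ (_ , _ , e)) = mk⇔ (subst (Covered μ) (≡-sym e)) (subst (Covered μ) e)
    same : ∀ v → Covered μ v ⇔ Covered μσ v
    same v = mk⇔
      (λ c → let y , e = Equivalence.to (covered-σ v) c
             in τ y , subst (λ z → M μ (σ v) z ≡ true) (≡-sym (transpose-inverse u w)) e)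
      (λ (y , e) → Equivalence.from (covered-σ v) (σ y , e))
    σu : σ u ≡ w
    σu with transpose-cases u w u
    ... | inj₁ (_ , e)              = e
    ... | inj₂ (inj₁ (u≡w , _))     = ⊥-elim (u≢w u≡w)
    ... | inj₂ (inj₂ (u≢u , _ , _)) = ⊥-elim (u≢u refl)
    -- The exchange fixes x: x = u would be a loop, and x = w would make the twins adjacent, hence
    -- give a loop at w.
    σx : σ x ≡ x
    σx with transpose-cases u w x
    ... | inj₁ (refl , _)         = ⊥-elim (true≢false ux (matching-irrefl μ u))
    ... | inj₂ (inj₁ (refl , _))  = ⊥-elim (true≢false (trans (≡-sym (twins w)) (M-edge μ u w ux)) (irrefl G w))
    ... | inj₂ (inj₂ (_ , _ , e)) = e
    wx : M μ w x ≡ true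
    wx = trans (≡-sym (cong₂ (M μ) σu σx)) (trans (≡-sym (ur μσ same u x)) ux)

  partners : V → ℕ
  partners v = countFin (n G) (M μ v)

  partners≤1 : ∀ v → partners v ≤ 1
  partners≤1 v = sum≤1 _ (λ u → ι≤1 (M μ v u)) λ i j p q → M-disj μ v i j (pos i p) (pos j q)
    where
    pos : ∀ u → ι (M μ v u) ≢ 0 → M μ v u ≡ true
    pos u h with M μ v u
    ... | true  = refl
    ... | false = ⊥-elim (h refl)

  partners≢0 : ∀ v → partners v ≢ 0 → Covered μ v
  partners≢0 v h = count>0⇒∈ {S = M μ v} (n≢0⇒n>0 h)

  partners-twins : UniquelyRestricted μ → ∀ T → (∀ u w → u ∈ T → w ∈ T → ∀ y → adj G u y ≡ adj G w y)
    → sumOver T partners ≤ 1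
  partners-twins ur T twins = sum≤1 _
    (λ i → *-mono-≤ (ι≤1 (T i)) (partners≤1 i))
    (λ i j p q → twins-not-both-covered ur i j (twins i j (∈T i p) (∈T j q)) (cov i p) (cov j q))
    where
    ∈T : ∀ i → ι (T i) * partners i ≢ 0 → i ∈ T
    ∈T i h with T i
    ... | true  = refl
    ... | false = ⊥-elim (h refl)
    cov : ∀ i → ι (T i) * partners i ≢ 0 → Covered μ i
    cov i h = partners≢0 i λ e → h (trans (cong (ι (T i) *_) e) (*-zeroʳ (ι (T i))))

-- Graphs all of whose components are blocks

full : ∀ {N} → Subset N
full _ = true

module _ (G : Graph) (Δ : ℕ) where

  private V = Fin (n G)

  module _ (μ : Matching G) (ur : UniquelyRestricted μ) where

    -- Its sum over all vertices is 2(Δ²|M| + m). The upper bound thus says that the average weight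
    -- is at most 2Δ, which can be checked on each block separately.
    weight : V → ℕ
    weight v = Δ * Δ * partners μ v + degree G v

    sumOver-weight : ∀ T r → (∀ u w → u ∈ T → w ∈ T → ∀ y → adj G u y ≡ adj G w y)
      → (∀ u → u ∈ T → degree G u ≡ r) → sumOver T weight ≤ Δ * Δ * 1 + count T * r
    sumOver-weight T r twins deg = ≤-trans
      (≤-reflexive (trans (sumOver-+ T _ _) (cong₂ _+_ (sumOver-*ˡ T (Δ * Δ) _)
        (trans (sumOver-cong {S = T} deg) (sumOver-const T r)))))
      (+-monoˡ-≤ _ (*-monoʳ-≤ (Δ * Δ) (partners-twins μ ur T twins)))

    -- Each side consists of twins, so at most one of its vertices is covered. With |A| = Δ and |B|
    -- = r, either side weighs at most Δ² + Δr, and the two bounds add up to 2Δ(Δ + r).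
    block-weight : ∀ {v} (blk : Block G Δ full v) → let open Block blk in
      sumOver A weight + sumOver B weight ≤ (count A + count B) * (2 * Δ)
    block-weight blk = ≤-trans
      (+-mono-≤
        (sumOver-weight A (count B)
          (λ u w u∈ w∈ y → trans (adj-A u y u∈ refl) (≡-sym (adj-A w y w∈ refl)))
          (λ u u∈ → sum-cong λ y → cong ι (adj-A u y u∈ refl)))
        (sumOver-weight B (count A)
          (λ u w u∈ w∈ y → trans (adj-B u y u∈ refl) (≡-sym (adj-B w y w∈ refl)))
          (λ u u∈ → sum-cong λ y → cong ι (adj-B u y u∈ refl))))
      (≤-reflexive (subst (λ a → (Δ * Δ * 1 + a * count B) + (Δ * Δ * 1 + count B * a) ≡ (a + count B) * (2 * Δ))
        (≡-sym ∣A∣≡Δ) (arith Δ (count B))))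
      where
      open Block blk
      arith : ∀ a b → (a * a * 1 + a * b) + (a * a * 1 + b * a) ≡ (a + b) * (2 * a)
      arith = solve-∀

    -- Induction over unions of components: closure under adjacency ensures that the block of a
    -- vertex of S lies in S and that what is left is again closed.
    blocks-weight : (∀ v → Block G Δ full v) → ∀ bound S → count S ≤ bound
      → (∀ x y → x ∈ S → adj G x y ≡ true → y ∈ S) → sumOver S weight ≤ count S * (2 * Δ)
    blocks-weight blks bound S le closed with argmin S (λ _ → 0)
    ... | inj₁ none = ≤-trans (≤-reflexive (trans (sum-cong {n G} λ v → cong (λ b → ι b * weight v) (none v)) (sum-zero (n G)))) z≤n
    blocks-weight blks zero S le closed | inj₂ (a , a∈ , _) = ⊥-elim (1+n≰n (≤-trans (∈⇒count>0 {S = S} a∈) le))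
    blocks-weight blks (suc bound) S le closed | inj₂ (a , a∈ , _) = ≤-trans
      (≤-reflexive (trans (sumOver-⊎ {S = S} {S′} {C} S≡ weight) (cong (sumOver S′ weight +_) (sumOver-⊎ {S = C} {A} {B} C≡ weight))))
      (≤-trans (+-mono-≤ (blocks-weight blks bound S′ smaller closed′) (block-weight (blks a)))
        (≤-reflexive (trans (≡-sym (*-distribʳ-+ (2 * Δ) (count S′) (count A + count B))) (cong (_* (2 * Δ)) (≡-sym ∣S∣)))))
      where
      open Block (blks a)
      C S′ : Subset (n G)
      C v = A v ∨ B v
      S′ v = S v ∧ not (C v)
      b∈ : ∃ λ b → b ∈ B
      b∈ = count>0⇒∈ {S = B} 1≤∣B∣
      -- Disjointness of the sides comes from the absence of loops.
      A∩B : ∀ v → v ∈ A → v ∉ B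
      A∩B v v∈ = trans (≡-sym (adj-A v v v∈ refl)) (irrefl G v)
      C≡ : C ≡ A ⊎ˢ B
      C≡ v = ι-∨ (A v) (B v) (A∩B v)
      C-closed : ∀ x y → x ∈ C → adj G x y ≡ true → y ∈ C
      C-closed x y x∈ xy with ∨-true {A x} x∈
      ... | inj₁ x∈A = ∨-introʳ (A y) (trans (≡-sym (adj-A x y x∈A refl)) xy)
      ... | inj₂ x∈B = ∨-introˡ (B y) (trans (≡-sym (adj-B x y x∈B refl)) xy)
      from-A : ∀ x → x ∈ A → x ∈ S → ∀ y → y ∈ C → y ∈ S
      from-A x x∈A x∈S y y∈ with ∨-true {A y} y∈
      ... | inj₂ y∈B = closed x y x∈S (trans (adj-A x y x∈A refl) y∈B)
      ... | inj₁ y∈A = closed b y (closed x b x∈S (trans (adj-A x b x∈A refl) (proj₂ b∈))) (trans (adj-B b y (proj₂ b∈) refl) y∈A)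
        where b = proj₁ b∈
      C⊆S : ∀ y → y ∈ C → y ∈ S
      C⊆S y y∈ with v∈A∪B
      ... | inj₁ a∈A = from-A a a∈A a∈ y y∈
      ... | inj₂ a∈B with ∨-true {A y} y∈
      ...   | inj₁ y∈A = closed a y a∈ (trans (adj-B a y a∈B refl) y∈A)
      -- Two vertices of B are joined through a vertex of A, which exists because |A| = Δ ≥ |B| ≥ 1.
      ...   | inj₂ y∈B with count>0⇒∈ {S = A} (≤-trans 1≤∣B∣ (≤-trans ∣B∣≤Δ (≤-reflexive (≡-sym ∣A∣≡Δ))))
      ...     | x , x∈A = from-A x x∈A (closed a x a∈ (trans (adj-B a x a∈B refl) x∈A)) y y∈
      S≡ : S ≡ S′ ⊎ˢ C
      S≡ v = trans (ι-split (S v) (C v)) (cong (λ b → ι (S′ v) + ι b)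
        (bool-ext (λ e → proj₂ (∧-true {S v} e)) (λ e → ∧-intro (C⊆S v e) e)))
      ∣S∣ : count S ≡ count S′ + (count A + count B)
      ∣S∣ = trans (count-⊎ {S = S} {S′} {C} S≡) (cong (count S′ +_) (count-⊎ {S = C} {A} {B} C≡))
      smaller : count S′ ≤ bound
      smaller = m+n≤1+o⇒m≤o (≤-trans 1≤∣B∣ (m≤n+m (count B) (count A))) (≤-trans (≤-reflexive (≡-sym ∣S∣)) le)
      closed′ : ∀ x y → x ∈ S′ → adj G x y ≡ true → y ∈ S′
      closed′ x y x∈ xy with C y in eq
      ... | false = ∧-intro (closed x y (proj₁ (∧-true x∈)) xy) refl
      ... | true  = ⊥-elim (true≢false (C-closed y x eq (trans (sym G y x) xy)) (not-true (proj₂ (∧-true {S x} x∈))))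

    blocks-upper-bound : (∀ v → Block G Δ full v) → Δ * Δ * size μ + edges G ≤ Δ * n G
    blocks-upper-bound blks = *-cancelˡ-≤ 2 (begin
      2 * (Δ * Δ * size μ + edges G)
        ≡⟨ arith (Δ * Δ) (size μ) (edges G) ⟩
      Δ * Δ * (2 * size μ) + 2 * edges G
        ≡⟨ ≡-sym (cong₂ (λ x y → Δ * Δ * x + y) (matching-handshake G μ) (handshake (n G) (adj G) (sym G) (irrefl G))) ⟩
      Δ * Δ * sumFin (n G) (partners μ) + sumFin (n G) (degree G)
        ≡⟨ ≡-sym (trans (sum-+ (n G) _ _) (cong (_+ sumFin (n G) (degree G)) (sum-*ˡ (n G) (Δ * Δ) (partners μ)))) ⟩
      sumFin (n G) weight
        ≡⟨ sum-cong (λ v → ≡-sym (*-identityˡ (weight v))) ⟩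
      sumOver full weight
        ≤⟨ blocks-weight blks (count {n G} full) full ≤-refl (λ _ _ _ _ → refl) ⟩
      count {n G} full * (2 * Δ)
        ≡⟨ cong (_* (2 * Δ)) (sum-one (n G)) ⟩
      n G * (2 * Δ)
        ≡⟨ arith′ (n G) Δ ⟩
      2 * (Δ * n G) ∎)
      where
      open ≤-Reasoning
      arith : ∀ d s e → 2 * (d * s + e) ≡ d * (2 * s) + 2 * e
      arith = solve-∀
      arith′ : ∀ x y → x * (2 * y) ≡ 2 * (y * x)
      arith′ = solve-∀

-- Blocks and complete bipartite components

enumerate : ∀ {N} (S : Subset N) → Σ (Fin (count S) → Fin N) λ f →
  Injective _≡_ _≡_ f × (∀ i → f i ∈ S) × (∀ v → v ∈ S → ∃ λ i → f i ≡ v)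
enumerate {zero}  S = (λ ()) , (λ { {()} }) , (λ ()) , λ ()
enumerate {suc N} S with enumerate (λ i → S (F.suc i)) | S F.zero in eq
... | f , inj , sound , complete | false =
      (λ i → F.suc (f i)) , (λ e → inj (suc-injective e)) , sound ,
      λ { F.zero v∈ → ⊥-elim (true≢false v∈ eq)
        ; (F.suc v) v∈ → let i , e = complete v v∈ in i , cong F.suc e }
... | f , inj , sound , complete | true = f′ , inj′ , (λ { F.zero → eq ; (F.suc i) → sound i }) ,
      λ { F.zero _ → F.zero , refl ; (F.suc v) v∈ → let i , e = complete v v∈ in F.suc i , cong F.suc e }
  where
  f′ : Fin (suc (count (λ i → S (F.suc i)))) → Fin (suc N)
  f′ F.zero    = F.zero
  f′ (F.suc i) = F.suc (f i)
  inj′ : Injective _≡_ _≡_ f′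
  inj′ {F.zero}  {F.zero}  _ = refl
  inj′ {F.suc i} {F.suc j} e = cong F.suc (inj (suc-injective e))

image : ∀ {K N} → (Fin K → Fin N) → Subset N
image f y = ⌊ any? (λ i → f i ≟ y) ⌋

image-∈ : ∀ {K N} (f : Fin K → Fin N) i → f i ∈ image f
image-∈ f i with any? (λ j → f j ≟ f i)
... | yes _ = refl
... | no ¬p = ⊥-elim (¬p (i , refl))

image-∋ : ∀ {K N} (f : Fin K → Fin N) y → y ∈ image f → ∃ λ i → f i ≡ y
image-∋ f y e with any? (λ i → f i ≟ y)
... | yes p = p

-- Double counting of the pairs (y, i) with y = f i: by injectivity each y in the image has exactly
-- one i.
count-image : ∀ {K N} (f : Fin K → Fin N) → Injective _≡_ _≡_ f → count (image f) ≡ K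
count-image {K} {N} f inj = begin
  sumFin N (λ y → ι (image f y))
    ≡⟨ sum-cong fibre ⟩
  sumFin N (λ y → sumFin K (λ i → ι ⌊ y ≟ f i ⌋))
    ≡⟨ sum-swap N K _ ⟩
  sumFin K (λ i → sumFin N (λ y → ι ⌊ y ≟ f i ⌋))
    ≡⟨ sum-cong (λ i → count-singleton (f i)) ⟩
  sumFin K (λ _ → 1)
    ≡⟨ sum-one K ⟩
  K ∎
  where
  open ≡-Reasoning
  pos : ∀ y i → ι ⌊ y ≟ f i ⌋ ≢ 0 → y ≡ f i
  pos y i h with y ≟ f i
  ... | yes e = e
  ... | no _  = ⊥-elim (h refl)
  fibre : ∀ y → ι (image f y) ≡ sumFin K (λ i → ι ⌊ y ≟ f i ⌋)
  fibre y with image f y in eq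
  ... | true with image-∋ f y eq
  ...   | i , refl = ≤-antisym (∈⇒count>0 {S = λ j → ⌊ f i ≟ f j ⌋} (⌊≟⌋-refl (f i)))
            (sum≤1 _ (λ j → ι≤1 ⌊ f i ≟ f j ⌋) λ j k p q → inj (trans (≡-sym (pos (f i) j p)) (pos (f i) k q)))
  fibre y | false with sumFin K (λ i → ι ⌊ y ≟ f i ⌋) in e
  ... | zero  = refl
  ... | suc _ with sum≢0⇒∃ (λ i → ι ⌊ y ≟ f i ⌋) (λ z → 1+n≢0 (trans (≡-sym e) z))
  ...   | i , h = ⊥-elim (true≢false (subst (_∈ image f) (≡-sym (pos y i h)) (image-∈ f i)) eq)

<⇒<ᵇ≡true : ∀ {a b} → a < b → (a <ᵇ b) ≡ true
<⇒<ᵇ≡true {zero}  (s≤s _) = refl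
<⇒<ᵇ≡true {suc a} (s≤s p) = <⇒<ᵇ≡true p

m+n<ᵇm : ∀ a b → (a + b <ᵇ a) ≡ false
m+n<ᵇm zero    b = refl
m+n<ᵇm (suc a) b = m+n<ᵇm a b

module _ (a b : ℕ) where

  left-side : ∀ (i : Fin a) → (toℕ (i ↑ˡ b) <ᵇ a) ≡ true
  left-side i = trans (cong (_<ᵇ a) (toℕ-↑ˡ i b)) (<⇒<ᵇ≡true (toℕ<n i))

  right-side : ∀ (j : Fin b) → (toℕ (a ↑ʳ j) <ᵇ a) ≡ false
  right-side j = trans (cong (_<ᵇ a) (toℕ-↑ʳ a j)) (m+n<ᵇm a (toℕ j))

  side : (i : Fin (a + b)) → (∃ λ j → j ↑ˡ b ≡ i) ⊎ (∃ λ j → a ↑ʳ j ≡ i)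
  side i with splitAt a i in eq
  ... | inj₁ j = inj₁ (j , splitAt⁻¹-↑ˡ eq)
  ... | inj₂ j = inj₂ (j , splitAt⁻¹-↑ʳ eq)

module _ (G : Graph) where

  private V = Fin (n G)

  iso⇒block : ∀ {Δ r v} → 1 ≤ r → r ≤ Δ → ComponentIsoK G v Δ r → Block G Δ full v
  iso⇒block {Δ} {r} {v} 1≤r r≤Δ (f , inj , reach , iso) = record
    { A = image left ; B = image right
    ; ∣A∣≡Δ = count-image left (λ e → ↑ˡ-injective r _ _ (inj e))
    ; 1≤∣B∣ = subst (1 ≤_) (≡-sym ∣B∣≡r) 1≤r
    ; ∣B∣≤Δ = subst (_≤ Δ) (≡-sym ∣B∣≡r) r≤Δ
    ; v∈A∪B = let i , e = Equivalence.to (reach v) here in in-component i e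
    ; A⊆S = λ _ _ → refl ; B⊆S = λ _ _ → refl
    ; adj-A = λ x y x∈ _ → let i , e = image-∋ left x x∈ in subst (λ z → adj G z y ≡ image right y) e (adj-left i y)
    ; adj-B = λ x y x∈ _ → let i , e = image-∋ right x x∈ in subst (λ z → adj G z y ≡ image left y) e (adj-right i y) }
    where
    left : Fin Δ → V
    left i = f (i ↑ˡ r)
    right : Fin r → V
    right j = f (Δ ↑ʳ j)
    ∣B∣≡r : count (image right) ≡ r
    ∣B∣≡r = count-image right (λ e → ↑ʳ-injective Δ _ _ (inj e))
    in-component : ∀ {u} i → f i ≡ u → u ∈ image left ⊎ u ∈ image right
    in-component i refl with side Δ r i
    ... | inj₁ (j , refl) = inj₁ (image-∈ left j)
    ... | inj₂ (j , refl) = inj₂ (image-∈ right j)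
    -- A block describes adjacency to all vertices of G, the isomorphism only adjacency within the
    -- component. Prolonging a walk by one edge shows that no neighbour lies outside.
    neighbour : ∀ i y → adj G (f i) y ≡ true → ∃ λ j → f j ≡ y
    neighbour i y e = Equivalence.to (reach y) (Reach-snoc (Equivalence.from (reach (f i)) (i , refl)))
      where
      Reach-snoc : ∀ {u} → Reach G u (f i) → Reach G u y
      Reach-snoc here       = step e here
      Reach-snoc (step p q) = step p (Reach-snoc q)
    adj-left : ∀ i y → adj G (left i) y ≡ image right y
    adj-left i y = bool-ext to from
      where
      to : adj G (left i) y ≡ true → y ∈ image right
      to e with neighbour _ y e
      ... | k , refl with side Δ r k
      ...   | inj₂ (j , refl) = image-∈ right j
      ...   | inj₁ (j , refl) = ⊥-elim (true≢false e (trans (iso _ _) (cong₂ _xor_ (left-side Δ r i) (left-side Δ r j))))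
      from : y ∈ image right → adj G (left i) y ≡ true
      from y∈ with image-∋ right y y∈
      ... | j , refl = trans (iso _ _) (cong₂ _xor_ (left-side Δ r i) (right-side Δ r j))
    adj-right : ∀ i y → adj G (right i) y ≡ image left y
    adj-right i y = bool-ext to from
      where
      to : adj G (right i) y ≡ true → y ∈ image left
      to e with neighbour _ y e
      ... | k , refl with side Δ r k
      ...   | inj₁ (j , refl) = image-∈ left j
      ...   | inj₂ (j , refl) = ⊥-elim (true≢false e (trans (iso _ _) (cong₂ _xor_ (right-side Δ r i) (right-side Δ r j))))
      from : y ∈ image left → adj G (right i) y ≡ true
      from y∈ with image-∋ left y y∈
      ... | j , refl = trans (iso _ _) (cong₂ _xor_ (right-side Δ r i) (left-side Δ r j))

  block⇒iso : ∀ {Δ v} (blk : Block G Δ full v) → ComponentIsoK G v Δ (count (Block.B blk))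
  -- The isomorphism is built on `count A` and `count B`, where both sides can be enumerated, and
  -- then transported along |A| = Δ.
  block⇒iso {Δ} {v} blk = subst (λ k → ComponentIsoK G v k (count B)) ∣A∣≡Δ (f , inj , reach , iso)
    where
    open Block blk
    α = count A
    β = count B
    enumA = enumerate A
    enumB = enumerate B
    fA = proj₁ enumA
    fB = proj₁ enumB
    f : Fin (α + β) → V
    f i = [ fA , fB ]′ (splitAt α i)
    f-left : ∀ i → f (i ↑ˡ β) ≡ fA i
    f-left i = cong [ fA , fB ]′ (splitAt-↑ˡ α i β)
    f-right : ∀ i → f (α ↑ʳ i) ≡ fB i
    f-right i = cong [ fA , fB ]′ (splitAt-↑ʳ α β i)
    left∈A : ∀ i → f (i ↑ˡ β) ∈ A
    left∈A i = subst (_∈ A) (≡-sym (f-left i)) (proj₁ (proj₂ (proj₂ enumA)) i)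
    right∈B : ∀ i → f (α ↑ʳ i) ∈ B
    right∈B i = subst (_∈ B) (≡-sym (f-right i)) (proj₁ (proj₂ (proj₂ enumB)) i)
    A∩B : ∀ {x} → x ∈ A → x ∉ B
    A∩B {x} x∈ = trans (≡-sym (adj-A x x x∈ refl)) (irrefl G x)
    B∩A : ∀ {x} → x ∈ B → x ∉ A
    B∩A {x} x∈ = trans (≡-sym (adj-B x x x∈ refl)) (irrefl G x)
    inj : Injective _≡_ _≡_ f
    inj {i} {j} e with side α β i | side α β j
    ... | inj₁ (i′ , refl) | inj₁ (j′ , refl) =
          cong (_↑ˡ β) (proj₁ (proj₂ enumA) (trans (≡-sym (f-left i′)) (trans e (f-left j′))))
    ... | inj₂ (i′ , refl) | inj₂ (j′ , refl) =
          cong (α ↑ʳ_) (proj₁ (proj₂ enumB) (trans (≡-sym (f-right i′)) (trans e (f-right j′))))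
    ... | inj₁ (i′ , refl) | inj₂ (j′ , refl) =
          ⊥-elim (true≢false (right∈B j′) (A∩B (subst (_∈ A) e (left∈A i′))))
    ... | inj₂ (i′ , refl) | inj₁ (j′ , refl) =
          ⊥-elim (true≢false (right∈B i′) (A∩B (subst (_∈ A) (≡-sym e) (left∈A j′))))
    iso : ∀ i j → adj G (f i) (f j) ≡ Kadj α β i j
    iso i j with side α β i | side α β j
    ... | inj₁ (i′ , refl) | inj₁ (j′ , refl) = trans (adj-A _ _ (left∈A i′) refl)
          (trans (A∩B (left∈A j′)) (≡-sym (cong₂ _xor_ (left-side α β i′) (left-side α β j′))))
    ... | inj₁ (i′ , refl) | inj₂ (j′ , refl) = trans (adj-A _ _ (left∈A i′) refl)
          (trans (right∈B j′) (≡-sym (cong₂ _xor_ (left-side α β i′) (right-side α β j′))))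
    ... | inj₂ (i′ , refl) | inj₁ (j′ , refl) = trans (adj-B _ _ (right∈B i′) refl)
          (trans (left∈A j′) (≡-sym (cong₂ _xor_ (right-side α β i′) (left-side α β j′))))
    ... | inj₂ (i′ , refl) | inj₂ (j′ , refl) = trans (adj-B _ _ (right∈B i′) refl)
          (trans (B∩A (right∈B j′)) (≡-sym (cong₂ _xor_ (right-side α β i′) (right-side α β j′))))
    a∈ : ∃ λ x → x ∈ A
    a∈ = count>0⇒∈ {S = A} (≤-trans 1≤∣B∣ (≤-trans ∣B∣≤Δ (≤-reflexive (≡-sym ∣A∣≡Δ))))
    b∈ : ∃ λ x → x ∈ B
    b∈ = count>0⇒∈ {S = B} 1≤∣B∣
    AB : ∀ {x y} → x ∈ A → y ∈ B → adj G x y ≡ true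
    AB {x} {y} x∈ y∈ = trans (adj-A x y x∈ refl) y∈
    BA : ∀ {x y} → x ∈ B → y ∈ A → adj G x y ≡ true
    BA {x} {y} x∈ y∈ = trans (adj-B x y x∈ refl) y∈
    connected : ∀ {x y} → x ∈ A ⊎ x ∈ B → y ∈ A ⊎ y ∈ B → Reach G x y
    connected (inj₁ x∈) (inj₂ y∈) = step (AB x∈ y∈) here
    connected (inj₂ x∈) (inj₁ y∈) = step (BA x∈ y∈) here
    connected (inj₁ x∈) (inj₁ y∈) = step (AB x∈ (proj₂ b∈)) (step (BA (proj₂ b∈) y∈) here)
    connected (inj₂ x∈) (inj₂ y∈) = step (BA x∈ (proj₂ a∈)) (step (AB (proj₂ a∈) y∈) here)
    closed : ∀ {x y} → Reach G x y → x ∈ A ⊎ x ∈ B → y ∈ A ⊎ y ∈ B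
    closed here       x∈ = x∈
    closed (step p q) (inj₁ x∈) = closed q (inj₂ (trans (≡-sym (adj-A _ _ x∈ refl)) p))
    closed (step p q) (inj₂ x∈) = closed q (inj₁ (trans (≡-sym (adj-B _ _ x∈ refl)) p))
    hit : ∀ {u} → u ∈ A ⊎ u ∈ B → ∃ λ i → f i ≡ u
    hit {u} (inj₁ u∈) = let i , e = proj₂ (proj₂ (proj₂ enumA)) u u∈ in i ↑ˡ β , trans (f-left i) e
    hit {u} (inj₂ u∈) = let i , e = proj₂ (proj₂ (proj₂ enumB)) u u∈ in α ↑ʳ i , trans (f-right i) e
    f∈ : ∀ i → f i ∈ A ⊎ f i ∈ B
    f∈ i with side α β i
    ... | inj₁ (j , refl) = inj₁ (left∈A j)
    ... | inj₂ (j , refl) = inj₂ (right∈B j)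
    reach : ∀ u → Reach G v u ⇔ (∃ λ i → f i ≡ u)
    reach u = mk⇔ (λ p → hit (closed p v∈A∪B)) (λ { (i , refl) → connected v∈A∪B (f∈ i) })

-- The inequality, cleared of denominators, and its equality case

theorem1 : (Δ : ℕ) → 1 ≤ Δ → (G : Graph)
    → (∀ v → degree G v ≤ Δ)
    → (∀ v → ∃ λ u → adj G v u ≡ true)
    → (k : ℕ) → IsNuUR G k
    → (Δ * n G ≤ Δ * Δ * k + edges G)
    × ((Δ * Δ * k + edges G ≡ Δ * n G)
    ⇔ (∀ v → ∃ λ r → 1 ≤ r × r ≤ Δ × ComponentIsoK G v Δ r))
theorem1 Δ _ G deg≤Δ noIso k ((μ , μ-ur , refl) , maximum) = lower , mk⇔ tight⇒iso iso⇒tight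
  where
  result : GreedyResult G Δ full
  result = greedy G Δ deg≤Δ (count {n G} full) full ≤-refl (λ v _ → let u , e = noIso v in u , refl , e)
  open GreedyResult result
  number≤k : number ≤ size μ
  number≤k = subst (_≤ size μ) (peelingMatching-size G peeling)
    (maximum (peelingMatching G peeling) (peelingMatching-UR G peeling))
  arcs-full : arcs G full full ≡ 2 * edges G
  arcs-full = trans (sum-cong {n G} λ v → trans (*-identityˡ _) (sum-cong {n G} λ u → *-identityˡ _))
    (handshake (n G) (adj G) (sym G) (irrefl G))
  arith : ∀ d m → 2 * d + 2 * m ≡ 2 * (d + m)
  arith = solve-∀
  balance′ : 2 * (Δ * n G) + slack ≡ 2 * (Δ * Δ * number + edges G)
  balance′ = trans (cong (λ c → 2 * (Δ * c) + slack) (≡-sym (sum-one (n G))))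
    (trans balance (trans (cong (2 * (Δ * Δ * number) +_) arcs-full) (arith (Δ * Δ * number) (edges G))))
  balance≤ : 2 * (Δ * n G) + slack ≤ 2 * (Δ * Δ * size μ + edges G)
  balance≤ = ≤-trans (≤-reflexive balance′) (*-monoʳ-≤ 2 (+-monoˡ-≤ (edges G) (*-monoʳ-≤ (Δ * Δ) number≤k)))
  lower : Δ * n G ≤ Δ * Δ * size μ + edges G
  lower = *-cancelˡ-≤ 2 (≤-trans (m≤m+n _ slack) balance≤)
  tight⇒iso : Δ * Δ * size μ + edges G ≡ Δ * n G → ∀ v → ∃ λ r → 1 ≤ r × r ≤ Δ × ComponentIsoK G v Δ r
  tight⇒iso e v = count (Block.B blk) , Block.1≤∣B∣ blk , Block.∣B∣≤Δ blk , block⇒iso G blk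
    where
    slack≡0 : slack ≡ 0
    -- The greedy matching is no larger than the maximum, so its slack is at most the gap in the
    -- inequality, which is zero here.
    slack≡0 = n≤0⇒n≡0 (+-cancelˡ-≤ (2 * (Δ * n G)) slack 0
      (≤-trans balance≤ (≤-reflexive (trans (cong (2 *_) e) (≡-sym (+-identityʳ _))))))
    blk : Block G Δ full v
    blk = tight slack≡0 v refl
  iso⇒tight : (∀ v → ∃ λ r → 1 ≤ r × r ≤ Δ × ComponentIsoK G v Δ r) → Δ * Δ * size μ + edges G ≡ Δ * n G
  iso⇒tight h = ≤-antisym
    (blocks-upper-bound G Δ μ μ-ur λ v → let r , 1≤r , r≤Δ , iso = h v in iso⇒block G 1≤r r≤Δ iso)
    lower
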